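{- Let $\mathcal{O}$ be a Henselian DVR with fraction field $K$, $F/K$ a finite Galois extension, $\mathcal{O}_F$ the integral closure of $\mathcal{O}$ in $F$, and $k_F$ the residue field of $\mathcal{O}_F$. Let $\mathcal{O}_F^{\mathrm{sh}}$ be the strict Henselisation of $\mathcal{O}_F$ and $F^{\mathrm{sh}}$ its fraction field. Let $G$ be a group with a homomorphism $\theta:G\to G_K$, acting through $\theta$ on $\mathrm{Spec}\,\bar K$ by $\sigma\mapsto(\theta(\sigma)^{ -1})^*$, and hence on $\mathrm{Spec}\,F$, $\mathrm{Spec}\,\mathcal{O}_F$, $\mathrm{Spec}\,k_F$, $\mathrm{Spec}\,\bar k_F$, $\mathrm{Spec}\,\mathcal{O}_F^{\mathrm{sh}}$, $\mathrm{Spec}\,F^{\mathrm{sh}}$. Let $X/F$ be a scheme on which $G$ acts semilinearly with respect to this action on $\mathrm{Spec}\,F$. Suppose $\mathcal{X}/\mathcal{O}_F$ is a model of $X$ such that for each $\sigma\in G$ the semilinear morphism $\sigma_X$ extends uniquely to a semilinear morphism $\sigma_{\mathcal{X}}:\mathcal{X}\to\mathcal{X}$. Then: (1) The map $\sigma\mapsto\sigma_{\mathcal{X}}$ defines a semilinear action of $G$ on $\mathcal{X}/\mathcal{O}_F$. In particular, it induces by base change a semilinear action of $G$ on the special fibre $\mathcal{X}_{k_F}$, and also induces actions on $\mathcal{X}(\mathcal{O}_F^{\mathrm{sh}})$ and $\mathcal{X}_{k_F}(\bar k_F)$. (2) The natural maps on points $\mathcal{X}(\mathcal{O}_F^{\mathrm{sh}})\to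 X(F^{\mathrm{sh}})$ and $\mathcal{X}(\mathcal{O}_F^{\mathrm{sh}})\to\mathcal{X}_{k_F}(\bar k_F)$ are $G$-equivariant. (3) Suppose $\mathcal{X}(\mathcal{O}_F^{\mathrm{sh}})\to X(F^{\mathrm{sh}})$ is bijective, and let $I$ be the image of $\mathcal{X}(\mathcal{O}_F^{\mathrm{sh}})\to\mathcal{X}_{k_F}(\bar k_F)$. Then the action of $\sigma\in G$ on $I$ is given by $$I\xrightarrow{\ \text{lift}\ }\mathcal{X}(\mathcal{O}_F^{\mathrm{sh}})\xrightarrow{=}X(F^{\mathrm{sh}})\xrightarrow{\ \sigma\ }X(F^{\mathrm{sh}})\xrightarrow{=}\mathcal{X}(\mathcal{O}_F^{\mathrm{sh}})\xrightarrow{\ \text{reduce}\ }I.$$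
   Context: $\bar L$ denotes the separable closure of a field $L$ and $G_L=\mathrm{Gal}(\bar L/L)$. A model $\mathcal{X}/\mathcal{O}_F$ of $X$ is simply a scheme over $\mathcal{O}_F$ with a specified isomorphism $i:\mathcal{X}\times_{\mathcal{O}_F}F\xrightarrow{\cong}X$. For a scheme $S$, $\alpha\in\mathrm{Aut}(S)$ and $S$-schemes $X,Y$, a morphism of schemes $f:X\to Y$ is $\alpha$-linear (semilinear) if $(Y\to S)\circ f=\alpha\circ(X\to S)$. If $G$ acts on $S$, then $G$ acts semilinearly on $X/S$ if $G$ acts (from the left) on the scheme $X$ and each automorphism $\sigma_X$ is $\sigma_S$-linear. In the theorem, $\sigma_{\mathcal{X}}$ is required to be linear over the automorphism of $\mathrm{Spec}\,\mathcal{O}_F$ given by $\sigma$. Action on points: if $G$ acts semilinearly on $X/S$ and $T/S$, then $G$ acts on $X(T)=\mathrm{Hom}_S(T,X)$ by $P\mapsto\sigma_X\circ P\circ\sigma_T^{ -1}$; for a ring $R$, $X(R)$ means $X(\mathrm{Spec}\,R)$. Base change action: if $G$ acts semilinearly on $X/S$ and $S'/S$, then $\sigma\in G$ acts on $X_{S'}=X\times_SS'$ by the unique morphism that is compatible with $\sigma_X$ and $\sigma_{S'}$ under the two projections. -}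

module Defs where

open import Level using (Level; suc; _⊔_)
open import Algebra.Bundles using (CommutativeRing; Group)
open import Algebra.Bundles.Raw using (RawMonoid; RawSemiring)
open import Algebra.Morphism.Bundles using (MonoidHomomorphism; GroupHomomorphism)
open import Algebra.Morphism.Structures using (IsMonoidHomomorphism; IsRingHomomorphism)
import Algebra.Morphism.Construct.Composition as Compose
import Algebra.Morphism.Construct.Identity as Identity
import Algebra.Definitions.RawSemiring as RawSemiringDefinitions
import Algebra.Properties.Group as GroupProperties
import Algebra.Properties.CommutativeSemigroup as CommutativeSemigroupProperties
import Algebra.Properties.Semiring.Exp as Exponentiation
import Algebra.Properties.Semiring.Sum as Sum
open import Data.Empty using (⊥-elim)
open import Data.Fin.Base using (Fin)
open import Data.Integer.Base as ℤ using (ℤ)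
open import Data.List.Base using (List; []; _∷_; _++_; map; foldr)
open import Data.List.Properties using (map-∘)
open import Data.List.Relation.Unary.All as All using (All; []; _∷_)
open import Data.Nat.Base as ℕ using (ℕ)
open import Data.Product using (Σ; Σ-syntax; ∃; ∃-syntax; ∃!; _×_; _,_; proj₁; proj₂)
open import Data.Sum.Base using (_⊎_; inj₁; inj₂)
open import Data.Vec.Functional using (Vector)
open import Function.Bundles using (Func; _⟨$⟩_; _⇔_; Equivalence)
open import Relation.Binary.Bundles using (Setoid)
open import Relation.Binary.PropositionalEquality.Core as ≡ using (_≡_)
open import Relation.Nullary.Negation.Core using (¬_)
import Function.Relation.Binary.Setoid.Equality as FuncEquality
import Relation.Binary.Reasoning.Setoid as SetoidReasoning

infix  4 _∋_≈_ _∋_≉_ _≐_ _≋_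
infixr 9 _∘ᵣ_ _∘ₛ_
infixr 1 _⟶_ _⇒_

CRing : ∀ ℓ → Set (suc ℓ)
CRing ℓ = CommutativeRing ℓ ℓ

∣_∣ : ∀ {ℓ} → CRing ℓ → Set ℓ
∣_∣ = CommutativeRing.Carrier

_∋_≈_ : ∀ {ℓ} (A : CRing ℓ) → ∣ A ∣ → ∣ A ∣ → Set ℓ
_∋_≈_ = CommutativeRing._≈_

_∋_≉_ : ∀ {ℓ} (A : CRing ℓ) → ∣ A ∣ → ∣ A ∣ → Set ℓ
A ∋ x ≉ y = ¬ (A ∋ x ≈ y)

record _⟶_ {ℓ} (A B : CRing ℓ) : Set ℓ where
  field
    ⟦_⟧                : ∣ A ∣ → ∣ B ∣
    isRingHomomorphism : IsRingHomomorphism (CommutativeRing.rawRing A) (CommutativeRing.rawRing B) ⟦_⟧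
  open IsRingHomomorphism isRingHomomorphism public

open _⟶_ public using (⟦_⟧)

_≐_ : ∀ {ℓ} {A B : CRing ℓ} → A ⟶ B → A ⟶ B → Set ℓ
_≐_ {B = B} f g = ∀ x → B ∋ ⟦ f ⟧ x ≈ ⟦ g ⟧ x

idᵣ : ∀ {ℓ} {A : CRing ℓ} → A ⟶ A
idᵣ {A = A} = record
  { ⟦_⟧                = λ x → x
  ; isRingHomomorphism = Identity.isRingHomomorphism rawRing refl
  } where open CommutativeRing A

_∘ᵣ_ : ∀ {ℓ} {A B C : CRing ℓ} → B ⟶ C → A ⟶ B → A ⟶ C
_∘ᵣ_ {C = C} g f = record
  { ⟦_⟧                = λ x → ⟦ g ⟧ (⟦ f ⟧ x)
  ; isRingHomomorphism = Compose.isRingHomomorphism (CommutativeRing.trans C)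
      (_⟶_.isRingHomomorphism f) (_⟶_.isRingHomomorphism g)
  }

Injective : ∀ {ℓ} {A B : CRing ℓ} → A ⟶ B → Set ℓ
Injective {A = A} {B} f = ∀ {x y} → B ∋ ⟦ f ⟧ x ≈ ⟦ f ⟧ y → A ∋ x ≈ y

Surjective : ∀ {ℓ} {A B : CRing ℓ} → A ⟶ B → Set ℓ
Surjective {B = B} f = ∀ y → ∃[ x ] (B ∋ ⟦ f ⟧ x ≈ y)

IsUnit : ∀ {ℓ} (A : CRing ℓ) → ∣ A ∣ → Set ℓ
IsUnit A x = ∃[ y ] (x * y ≈ 1#)
  where open CommutativeRing A

IsField : ∀ {ℓ} → CRing ℓ → Set ℓ
IsField A = 1# ≉ 0# × (∀ x → x ≈ 0# ⊎ IsUnit A x)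
  where open CommutativeRing A

IsFractionField : ∀ {ℓ} {A K : CRing ℓ} → A ⟶ K → Set ℓ
IsFractionField {A = A} {K} j =
  IsField K × Injective j ×
  (∀ x → ∃[ a ] ∃[ b ] (A ∋ b ≉ A.0# × K ∋ x K.* ⟦ j ⟧ b ≈ ⟦ j ⟧ a))
  where
  module A = CommutativeRing A
  module K = CommutativeRing K

-- A surjection onto a field that reflects units has the set of non-units as
-- its kernel; so A is local and k is its quotient by the maximal ideal.
IsResidueField : ∀ {ℓ} {A k : CRing ℓ} → A ⟶ k → Set ℓ
IsResidueField {A = A} {k} π =
  IsField k × Surjective π × (∀ x → IsUnit k (⟦ π ⟧ x) → IsUnit A x)

IsLocalHomomorphism : ∀ {ℓ} {A B : CRing ℓ} → A ⟶ B → Set ℓ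
IsLocalHomomorphism {A = A} {B} f = ∀ x → IsUnit B (⟦ f ⟧ x) → IsUnit A x

-- Coefficient lists, constant term first, compared coefficientwise.
Poly : ∀ {ℓ} → CRing ℓ → Set ℓ
Poly A = List ∣ A ∣

module _ {ℓ : Level} (A : CRing ℓ) where
  open CommutativeRing A

  coeff : Poly A → ℕ → Carrier
  coeff []      _         = 0#
  coeff (a ∷ p) ℕ.zero    = a
  coeff (a ∷ p) (ℕ.suc n) = coeff p n

  EqualPoly : Poly A → Poly A → Set ℓ
  EqualPoly p q = ∀ n → coeff p n ≈ coeff q n

  addₚ : Poly A → Poly A → Poly A
  addₚ []      q       = q
  addₚ (a ∷ p) []      = a ∷ p
  addₚ (a ∷ p) (b ∷ q) = (a + b) ∷ addₚ p q

  scaleₚ : Carrier → Poly A → Poly A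
  scaleₚ a = map (a *_)

  mulₚ : Poly A → Poly A → Poly A
  mulₚ []      q = []
  mulₚ (a ∷ p) q = addₚ (scaleₚ a q) (0# ∷ mulₚ p q)

  -- (a + X p)′ = p + X p′
  derivₚ : Poly A → Poly A
  derivₚ []      = []
  derivₚ (a ∷ p) = addₚ p (0# ∷ derivₚ p)

  eval : Poly A → Carrier → Carrier
  eval []      x = 0#
  eval (a ∷ p) x = a + x * eval p x

  polySemiring : RawSemiring ℓ ℓ
  polySemiring = record
    { Carrier = Poly A ; _≈_ = EqualPoly ; _+_ = addₚ ; _*_ = mulₚ
    ; 0# = [] ; 1# = 1# ∷ [] }

  IsMonic : Poly A → Set ℓ
  IsMonic p = ∃[ n ] (coeff p n ≈ 1# × (∀ m → n ℕ.< m → coeff p m ≈ 0#))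

  IsIrreducible : Poly A → Set ℓ
  IsIrreducible = RawSemiringDefinitions.Irreducible polySemiring

  IsSeparable : Poly A → Set ℓ
  IsSeparable p = ∃[ u ] ∃[ v ] (EqualPoly (addₚ (mulₚ u p) (mulₚ v (derivₚ p))) (1# ∷ []))

  -- (X - x₁) ⋯ (X - xₙ)
  linearProduct : List Carrier → Poly A
  linearProduct = foldr (λ x → mulₚ (- x ∷ 1# ∷ [])) (1# ∷ [])

  -- Only used for monic p.
  Splits : Poly A → Set ℓ
  Splits p = ∃[ xs ] (EqualPoly p (linearProduct xs))

mapₚ : ∀ {ℓ} {A B : CRing ℓ} → A ⟶ B → Poly A → Poly B
mapₚ f = map ⟦ f ⟧

IsRoot : ∀ {ℓ} {A B : CRing ℓ} → A ⟶ B → Poly A → ∣ B ∣ → Set ℓ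
IsRoot {B = B} f p x = B ∋ eval B (mapₚ f p) x ≈ CommutativeRing.0# B

IsIntegral : ∀ {ℓ} {A R : CRing ℓ} → A ⟶ R → ∣ R ∣ → Set ℓ
IsIntegral {A = A} f x = ∃[ p ] (IsMonic A p × IsRoot f p x)

-- C, embedded in R by c, is the integral closure in R of the A-algebra f.
IsIntegralClosure : ∀ {ℓ} {A C R : CRing ℓ} → A ⟶ R → C ⟶ R → Set ℓ
IsIntegralClosure {R = R} f c =
  Injective c × (∀ x → IsIntegral f x ⇔ (∃[ y ] (R ∋ ⟦ c ⟧ y ≈ x)))

IsMinimalPolynomial : ∀ {ℓ} {k E : CRing ℓ} → k ⟶ E → ∣ E ∣ → Poly k → Set ℓ
IsMinimalPolynomial {k = k} f x p = IsMonic k p × IsIrreducible k p × IsRoot f p x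

IsSeparablyClosed : ∀ {ℓ} → CRing ℓ → Set ℓ
IsSeparablyClosed E = IsField E × (∀ p → IsMonic E p → IsSeparable E p → Splits E p)

IsSeparableClosure : ∀ {ℓ} {k E : CRing ℓ} → k ⟶ E → Set ℓ
IsSeparableClosure {k = k} {E} f =
  IsField k × IsSeparablyClosed E ×
  (∀ x → ∃[ p ] (IsMinimalPolynomial f x p × IsSeparable k p))

IsFinite : ∀ {ℓ} {k E : CRing ℓ} → k ⟶ E → Set ℓ
IsFinite {k = k} {E} f =
  ∃[ n ] Σ[ e ∈ Vector ∣ E ∣ n ] (∀ x → Σ[ c ∈ Vector ∣ k ∣ n ]
    (x ≈ sum (λ i → ⟦ f ⟧ (c i) * e i)))
  where
  open CommutativeRing E
  open Sum semiring using (sum)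

-- Separability and normality are read off from minimal polynomials.
IsFiniteGalois : ∀ {ℓ} {k E : CRing ℓ} → k ⟶ E → Set ℓ
IsFiniteGalois {k = k} {E} f =
  IsField k × IsField E × IsFinite f ×
  (∀ x → ∃[ p ] (IsMinimalPolynomial f x p × IsSeparable k p × Splits E (mapₚ f p)))

-- The value of v at 0 is irrelevant.
record IsDiscreteValuation {ℓ} (K : CRing ℓ) (v : ∣ K ∣ → ℤ) : Set ℓ where
  open CommutativeRing K
  field
    v-cong     : ∀ {x y} → x ≈ y → v x ≡ v y
    v-*        : ∀ {x y} → x ≉ 0# → y ≉ 0# → v (x * y) ≡ v x ℤ.+ v y
    v-+        : ∀ {x y} → x ≉ 0# → y ≉ 0# → x + y ≉ 0# → v x ℤ.⊓ v y ℤ.≤ v (x + y)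
    v-surjects : ∀ n → ∃[ x ] (x ≉ 0# × v x ≡ n)

IsDVR : ∀ {ℓ} {O K : CRing ℓ} → O ⟶ K → Set ℓ
IsDVR {O = O} {K} j =
  IsFractionField j × Σ[ v ∈ (∣ K ∣ → ℤ) ] (IsDiscreteValuation K v ×
    (∀ x → (∃[ a ] (K ∋ ⟦ j ⟧ a ≈ x)) ⇔ (x ≈ 0# ⊎ ℤ.0ℤ ℤ.≤ v x)))
  where open CommutativeRing K

IsHenselian : ∀ {ℓ} {A k : CRing ℓ} → A ⟶ k → Set ℓ
IsHenselian {A = A} {k} π =
  IsResidueField π ×
  (∀ p → IsMonic A p → ∀ x →
    k ∋ eval k (mapₚ π p) x ≈ k.0# → k ∋ eval k (derivₚ k (mapₚ π p)) x ≉ k.0# →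
    ∃[ a ] (A ∋ eval A p a ≈ CommutativeRing.0# A × k ∋ ⟦ π ⟧ a ≈ x))
  where module k = CommutativeRing k

IsStrictlyHenselian : ∀ {ℓ} {A k : CRing ℓ} → A ⟶ k → Set ℓ
IsStrictlyHenselian {k = k} π = IsHenselian π × IsSeparablyClosed k

-- Aˢʰ is the strict Henselisation of the local ring A with respect to the
-- separable closure ι of its residue field (EGA IV, 18.8): local homomorphisms
-- u to a strictly Henselian B, together with an embedding α of the separable
-- closure in the residue field of B, extend uniquely to Aˢʰ.
record IsStrictHenselisation {ℓ} {A k Aˢʰ k̄ : CRing ℓ}
  (π : A ⟶ k) (ι : k ⟶ k̄) (i : A ⟶ Aˢʰ) (πˢʰ : Aˢʰ ⟶ k̄) : Set (suc ℓ) where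
  field
    isResidueField      : IsResidueField π
    isSeparableClosure  : IsSeparableClosure ι
    isStrictlyHenselian : IsStrictlyHenselian πˢʰ
    isLocal             : IsLocalHomomorphism i
    commutes            : πˢʰ ∘ᵣ i ≐ ι ∘ᵣ π
    universal           : ∀ {B κ : CRing ℓ} (πᴮ : B ⟶ κ) → IsStrictlyHenselian πᴮ →
                          (u : A ⟶ B) → IsLocalHomomorphism u →
                          (α : k̄ ⟶ κ) → πᴮ ∘ᵣ u ≐ α ∘ᵣ ι ∘ᵣ π →
                          ∃! _≐_ (λ w → IsLocalHomomorphism w × w ∘ᵣ i ≐ u × πᴮ ∘ᵣ w ≐ α ∘ᵣ πˢʰ)

module _ {ℓ : Level} (A B : CRing ℓ) where
  private
    module A = CommutativeRing A
    module B = CommutativeRing B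
    module GP = GroupProperties B.+-group

  homomorphism : (f : ∣ A ∣ → ∣ B ∣) → (∀ {x y} → A ∋ x ≈ y → B ∋ f x ≈ f y) →
    (∀ x y → B ∋ f (x A.+ y) ≈ f x B.+ f y) → (∀ x y → B ∋ f (x A.* y) ≈ f x B.* f y) →
    B ∋ f A.1# ≈ B.1# → A ⟶ B
  homomorphism f f-cong f-+ f-* f-1 = record
    { ⟦_⟧ = f
    ; isRingHomomorphism = record
      { isSemiringHomomorphism = record
        { isNearSemiringHomomorphism = record
          { +-isMonoidHomomorphism = record
            { isMagmaHomomorphism = record
              { isRelHomomorphism = record { cong = f-cong } ; homo = f-+ }
            ; ε-homo = f-0 }
          ; *-homo = f-* }
        ; 1#-homo = f-1 }
      ; -‿homo = λ x → GP.inverseʳ-unique (f x) (f (A.- x))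
          (B.trans (B.sym (f-+ x (A.- x))) (B.trans (f-cong (A.-‿inverseʳ x)) f-0)) }
    }
    where
    f-0 : B ∋ f A.0# ≈ B.0#
    f-0 = GP.identityʳ-unique (f A.0#) (f A.0#)
            (B.trans (B.sym (f-+ A.0# A.0#)) (f-cong (A.+-identityʳ A.0#)))

private
  module Hom {ℓ} {A B : CRing ℓ} (f : A ⟶ B) = _⟶_ f

  unit-map : ∀ {ℓ} {A B : CRing ℓ} (f : A ⟶ B) {x} → IsUnit A x → IsUnit B (⟦ f ⟧ x)
  unit-map {A = A} {B} f {x} (y , xy≈1) = ⟦ f ⟧ y ,
    trans (sym (Hom.*-homo f x y)) (trans (Hom.⟦⟧-cong f xy≈1) (Hom.1#-homo f))
    where open CommutativeRing B

  module Field {ℓ} (K : CRing ℓ) (isField : IsField K) where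
    open CommutativeRing K
    open SetoidReasoning setoid

    no-zero-divisors : ∀ x y → x * y ≈ 0# → x ≈ 0# ⊎ y ≈ 0#
    no-zero-divisors x y xy≈0 with proj₂ isField x
    ... | inj₁ x≈0        = inj₁ x≈0
    ... | inj₂ (z , xz≈1) = inj₂ (begin
      y            ≈⟨ *-identityˡ y ⟨
      1# * y       ≈⟨ *-congʳ (trans (*-comm z x) xz≈1) ⟨
      (z * x) * y  ≈⟨ *-assoc z x y ⟩
      z * (x * y)  ≈⟨ *-congˡ xy≈0 ⟩
      z * 0#       ≈⟨ zeroʳ z ⟩
      0#           ∎)

    nonzero-* : ∀ {x y} → x ≉ 0# → y ≉ 0# → x * y ≉ 0#
    nonzero-* {x} {y} x≉0 y≉0 xy≈0 with no-zero-divisors x y xy≈0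
    ... | inj₁ x≈0 = x≉0 x≈0
    ... | inj₂ y≈0 = y≉0 y≈0

    inverse : ∀ {x} → x ≉ 0# → ∃[ y ] (x * y ≈ 1#)
    inverse {x} x≉0 with proj₂ isField x
    ... | inj₁ x≈0 = ⊥-elim (x≉0 x≈0)
    ... | inj₂ u   = u

    cancelʳ : ∀ {x y z} → z ≉ 0# → x * z ≈ y * z → x ≈ y
    cancelʳ {x} {y} {z} z≉0 xz≈yz with inverse z≉0
    ... | w , zw≈1 = begin
      x            ≈⟨ trans (*-congˡ zw≈1) (*-identityʳ x) ⟨
      x * (z * w)  ≈⟨ *-assoc x z w ⟨
      (x * z) * w  ≈⟨ *-congʳ xz≈yz ⟩
      (y * z) * w  ≈⟨ *-assoc y z w ⟩
      y * (z * w)  ≈⟨ trans (*-congˡ zw≈1) (*-identityʳ y) ⟩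
      y            ∎

    unit-nonzero : ∀ {x} → IsUnit K x → x ≉ 0#
    unit-nonzero {x} (y , xy≈1) x≈0 =
      proj₁ isField (trans (sym xy≈1) (trans (*-congʳ x≈0) (zeroˡ y)))

  module PolyLemmas {ℓ} (A : CRing ℓ) where
    open CommutativeRing A
    open SetoidReasoning setoid

    _≈ₚ_ : Poly A → Poly A → Set ℓ
    _≈ₚ_ = EqualPoly A

    coeff-+ : ∀ p q n → coeff A (addₚ A p q) n ≈ coeff A p n + coeff A q n
    coeff-+ []      q       n         = sym (+-identityˡ _)
    coeff-+ (a ∷ p) []      n         = sym (+-identityʳ _)
    coeff-+ (a ∷ p) (b ∷ q) ℕ.zero    = refl
    coeff-+ (a ∷ p) (b ∷ q) (ℕ.suc n) = coeff-+ p q n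

    coeff-scale : ∀ a p n → coeff A (scaleₚ A a p) n ≈ a * coeff A p n
    coeff-scale a []      n         = sym (zeroʳ a)
    coeff-scale a (b ∷ p) ℕ.zero    = refl
    coeff-scale a (b ∷ p) (ℕ.suc n) = coeff-scale a p n

    ∷-cong : ∀ {a b p q} → a ≈ b → p ≈ₚ q → (a ∷ p) ≈ₚ (b ∷ q)
    ∷-cong a≈b p≈q ℕ.zero    = a≈b
    ∷-cong a≈b p≈q (ℕ.suc n) = p≈q n

    add-cong : ∀ p p′ q q′ → p ≈ₚ p′ → q ≈ₚ q′ → addₚ A p q ≈ₚ addₚ A p′ q′
    add-cong p p′ q q′ p≈p′ q≈q′ n =
      trans (coeff-+ p q n) (trans (+-cong (p≈p′ n) (q≈q′ n)) (sym (coeff-+ p′ q′ n)))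

    scale-cong : ∀ a p q → p ≈ₚ q → scaleₚ A a p ≈ₚ scaleₚ A a q
    scale-cong a p q p≈q n =
      trans (coeff-scale a p n) (trans (*-congˡ (p≈q n)) (sym (coeff-scale a q n)))

    mul-congʳ : ∀ p {q q′} → q ≈ₚ q′ → mulₚ A p q ≈ₚ mulₚ A p q′
    mul-congʳ []      q≈q′ n = refl
    mul-congʳ (a ∷ p) {q} {q′} q≈q′ =
      add-cong (scaleₚ A a q) (scaleₚ A a q′) (0# ∷ mulₚ A p q) (0# ∷ mulₚ A p q′)
        (scale-cong a q q′ q≈q′) (∷-cong {p = mulₚ A p q} refl (mul-congʳ p {q} {q′} q≈q′))

    eval-zero : ∀ p → (∀ n → coeff A p n ≈ 0#) → ∀ x → eval A p x ≈ 0#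
    eval-zero []      p≈0 x = refl
    eval-zero (a ∷ p) p≈0 x = begin
      a + x * eval A p x  ≈⟨ +-cong (p≈0 0) (*-congˡ (eval-zero p (λ n → p≈0 (ℕ.suc n)) x)) ⟩
      0# + x * 0#         ≈⟨ trans (+-identityˡ _) (zeroʳ x) ⟩
      0#                  ∎

    eval-cong : ∀ p q → p ≈ₚ q → ∀ x → eval A p x ≈ eval A q x
    eval-cong []      q       p≈q x = sym (eval-zero q (λ n → sym (p≈q n)) x)
    eval-cong (a ∷ p) []      p≈q x = eval-zero (a ∷ p) p≈q x
    eval-cong (a ∷ p) (b ∷ q) p≈q x =
      +-cong (p≈q 0) (*-congˡ (eval-cong p q (λ n → p≈q (ℕ.suc n)) x))

    eval-+ : ∀ p q x → eval A (addₚ A p q) x ≈ eval A p x + eval A q x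
    eval-+ []      q       x = sym (+-identityˡ _)
    eval-+ (a ∷ p) []      x = sym (+-identityʳ _)
    eval-+ (a ∷ p) (b ∷ q) x = begin
      (a + b) + x * eval A (addₚ A p q) x            ≈⟨ +-congˡ (trans (*-congˡ (eval-+ p q x)) (distribˡ x _ _)) ⟩
      (a + b) + (x * eval A p x + x * eval A q x)    ≈⟨ +-assoc a b _ ⟩
      a + (b + (x * eval A p x + x * eval A q x))    ≈⟨ +-congˡ (+-assoc b _ _) ⟨
      a + ((b + x * eval A p x) + x * eval A q x)    ≈⟨ +-congˡ (+-congʳ (+-comm b _)) ⟩
      a + ((x * eval A p x + b) + x * eval A q x)    ≈⟨ +-congˡ (+-assoc _ b _) ⟩
      a + (x * eval A p x + (b + x * eval A q x))    ≈⟨ +-assoc a _ _ ⟨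
      (a + x * eval A p x) + (b + x * eval A q x)    ∎

    eval-scale : ∀ a p x → eval A (scaleₚ A a p) x ≈ a * eval A p x
    eval-scale a []      x = sym (zeroʳ a)
    eval-scale a (b ∷ p) x = begin
      a * b + x * eval A (scaleₚ A a p) x  ≈⟨ +-congˡ (*-congˡ (eval-scale a p x)) ⟩
      a * b + x * (a * eval A p x)         ≈⟨ +-congˡ (trans (sym (*-assoc x a _)) (trans (*-congʳ (*-comm x a)) (*-assoc a x _))) ⟩
      a * b + a * (x * eval A p x)         ≈⟨ distribˡ a b _ ⟨
      a * (b + x * eval A p x)             ∎

    eval-* : ∀ p q x → eval A (mulₚ A p q) x ≈ eval A p x * eval A q x
    eval-* []      q x = sym (zeroˡ _)
    eval-* (a ∷ p) q x = begin
      eval A (addₚ A (scaleₚ A a q) (0# ∷ mulₚ A p q)) x        ≈⟨ eval-+ (scaleₚ A a q) (0# ∷ mulₚ A p q) x ⟩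
      eval A (scaleₚ A a q) x + (0# + x * eval A (mulₚ A p q) x) ≈⟨ +-cong (eval-scale a q x) (trans (+-identityˡ _) (*-congˡ (eval-* p q x))) ⟩
      a * eval A q x + x * (eval A p x * eval A q x)            ≈⟨ +-congˡ (*-assoc x _ _) ⟨
      a * eval A q x + (x * eval A p x) * eval A q x            ≈⟨ distribʳ _ a _ ⟨
      (a + x * eval A p x) * eval A q x                         ∎

  module PolyMap {ℓ} {A B : CRing ℓ} (f : A ⟶ B) where
    private
      module A = CommutativeRing A
    open CommutativeRing B
    open _⟶_ f using (⟦⟧-cong; +-homo; *-homo; 0#-homo; 1#-homo; -‿homo)
    open PolyLemmas B

    coeff-map : ∀ p n → coeff B (mapₚ f p) n ≈ ⟦ f ⟧ (coeff A p n)
    coeff-map []      n         = sym 0#-homo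
    coeff-map (a ∷ p) ℕ.zero    = refl
    coeff-map (a ∷ p) (ℕ.suc n) = coeff-map p n

    map-cong : ∀ p q → EqualPoly A p q → mapₚ f p ≈ₚ mapₚ f q
    map-cong p q p≈q n = trans (coeff-map p n) (trans (⟦⟧-cong (p≈q n)) (sym (coeff-map q n)))

    map-add : ∀ p q → mapₚ f (addₚ A p q) ≈ₚ addₚ B (mapₚ f p) (mapₚ f q)
    map-add []      q       n = refl
    map-add (a ∷ p) []      n = refl
    map-add (a ∷ p) (b ∷ q)   = ∷-cong {p = mapₚ f (addₚ A p q)} (+-homo a b) (map-add p q)

    map-scale : ∀ a p → mapₚ f (scaleₚ A a p) ≈ₚ scaleₚ B (⟦ f ⟧ a) (mapₚ f p)
    map-scale a []      n = refl
    map-scale a (b ∷ p)   = ∷-cong {p = mapₚ f (scaleₚ A a p)} (*-homo a b) (map-scale a p)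

    map-mul : ∀ p q → mapₚ f (mulₚ A p q) ≈ₚ mulₚ B (mapₚ f p) (mapₚ f q)
    map-mul []      q n = refl
    map-mul (a ∷ p) q n = trans
      (map-add (scaleₚ A a q) (A.0# ∷ mulₚ A p q) n)
      (add-cong (mapₚ f (scaleₚ A a q)) (scaleₚ B (⟦ f ⟧ a) (mapₚ f q))
        (⟦ f ⟧ A.0# ∷ mapₚ f (mulₚ A p q)) (0# ∷ mulₚ B (mapₚ f p) (mapₚ f q))
        (map-scale a q) (∷-cong {p = mapₚ f (mulₚ A p q)} 0#-homo (map-mul p q)) n)

    map-deriv : ∀ p → mapₚ f (derivₚ A p) ≈ₚ derivₚ B (mapₚ f p)
    map-deriv []      n = refl
    map-deriv (a ∷ p) n = trans
      (map-add p (A.0# ∷ derivₚ A p) n)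
      (add-cong (mapₚ f p) (mapₚ f p) (⟦ f ⟧ A.0# ∷ mapₚ f (derivₚ A p)) (0# ∷ derivₚ B (mapₚ f p))
        (λ _ → refl) (∷-cong {p = mapₚ f (derivₚ A p)} 0#-homo (map-deriv p)) n)

    map-eval : ∀ p x → ⟦ f ⟧ (eval A p x) ≈ eval B (mapₚ f p) (⟦ f ⟧ x)
    map-eval []      x = 0#-homo
    map-eval (a ∷ p) x = trans (+-homo a _) (+-congˡ (trans (*-homo x _) (*-congˡ (map-eval p x))))

    map-monic : ∀ p → IsMonic A p → IsMonic B (mapₚ f p)
    map-monic p (n , lead , above) = n ,
      trans (coeff-map p n) (trans (⟦⟧-cong lead) 1#-homo) ,
      λ m n<m → trans (coeff-map p m) (trans (⟦⟧-cong (above m n<m)) 0#-homo)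

    map-separable : ∀ p → IsSeparable A p → IsSeparable B (mapₚ f p)
    map-separable p (u , v , bezout) = mapₚ f u , mapₚ f v , λ n → begin
      coeff B (addₚ B (mulₚ B (mapₚ f u) (mapₚ f p)) (mulₚ B (mapₚ f v) (derivₚ B (mapₚ f p)))) n
        ≈⟨ add-cong (mapₚ f (mulₚ A u p)) (mulₚ B (mapₚ f u) (mapₚ f p))
             (mapₚ f (mulₚ A v (derivₚ A p))) (mulₚ B (mapₚ f v) (derivₚ B (mapₚ f p)))
             (map-mul u p)
             (λ m → trans (map-mul v (derivₚ A p) m) (mul-congʳ (mapₚ f v) {mapₚ f (derivₚ A p)} (map-deriv p) m)) n ⟨
      coeff B (addₚ B (mapₚ f (mulₚ A u p)) (mapₚ f (mulₚ A v (derivₚ A p)))) n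
        ≈⟨ map-add (mulₚ A u p) (mulₚ A v (derivₚ A p)) n ⟨
      coeff B (mapₚ f (addₚ A (mulₚ A u p) (mulₚ A v (derivₚ A p)))) n
        ≈⟨ map-cong (addₚ A (mulₚ A u p) (mulₚ A v (derivₚ A p))) (A.1# ∷ []) bezout n ⟩
      coeff B (⟦ f ⟧ A.1# ∷ []) n
        ≈⟨ ∷-cong {p = []} {q = []} 1#-homo (λ _ → refl) n ⟩
      coeff B (1# ∷ []) n ∎
      where open SetoidReasoning setoid

    root-of-linearProduct : IsField B → ∀ xs y →
      eval B (mapₚ f (linearProduct A xs)) y ≈ 0# → ∃[ x ] (⟦ f ⟧ x ≈ y)
    root-of-linearProduct isField [] y 1≈0 = ⊥-elim (proj₁ isField (begin
      1#                   ≈⟨ 1#-homo ⟨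
      ⟦ f ⟧ A.1#           ≈⟨ +-identityʳ _ ⟨
      ⟦ f ⟧ A.1# + 0#      ≈⟨ +-congˡ (zeroʳ y) ⟨
      ⟦ f ⟧ A.1# + y * 0#  ≈⟨ 1≈0 ⟩
      0#                   ∎))
      where open SetoidReasoning setoid
    root-of-linearProduct isField (x ∷ xs) y root
      with Field.no-zero-divisors B isField _ _ product≈0
      where
      l : Poly A
      l = A.- x ∷ A.1# ∷ []
      product≈0 : eval B (mapₚ f l) y * eval B (mapₚ f (linearProduct A xs)) y ≈ 0#
      product≈0 = trans (sym (eval-* (mapₚ f l) (mapₚ f (linearProduct A xs)) y))
        (trans (sym (eval-cong (mapₚ f (mulₚ A l (linearProduct A xs))) (mulₚ B (mapₚ f l) (mapₚ f (linearProduct A xs)))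
          (map-mul l (linearProduct A xs)) y)) root)
    ... | inj₂ root′ = root-of-linearProduct isField xs y root′
    ... | inj₁ y-x≈0 = x , sym (x∙y⁻¹≈ε⇒x≈y y (⟦ f ⟧ x) (begin
      y + - ⟦ f ⟧ x                                       ≈⟨ +-comm y _ ⟩
      - ⟦ f ⟧ x + y                                       ≈⟨ +-cong (-‿homo x) (*-identityʳ y) ⟨
      ⟦ f ⟧ (A.- x) + y * 1#                              ≈⟨ +-congˡ (*-congˡ (trans (+-cong 1#-homo (zeroʳ y)) (+-identityʳ 1#))) ⟨
      ⟦ f ⟧ (A.- x) + y * (⟦ f ⟧ A.1# + y * 0#)           ≈⟨ y-x≈0 ⟩
      0#                                                  ∎))
      where
      open SetoidReasoning setoid
      open GroupProperties +-group using (x∙y⁻¹≈ε⇒x≈y)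

  eval-map-cong : ∀ {ℓ} {A B : CRing ℓ} (f g : A ⟶ B) → f ≐ g →
    ∀ p x → B ∋ eval B (mapₚ f p) x ≈ eval B (mapₚ g p) x
  eval-map-cong {B = B} f g f≐g p x = PolyLemmas.eval-cong B (mapₚ f p) (mapₚ g p)
    (λ n → B.trans (PolyMap.coeff-map f p n) (B.trans (f≐g _) (B.sym (PolyMap.coeff-map g p n)))) x
    where module B = CommutativeRing B

  root-map : ∀ {ℓ} {A B C : CRing ℓ} (f : A ⟶ B) (g : B ⟶ C) (f′ : A ⟶ C) → g ∘ᵣ f ≐ f′ →
    ∀ p x → IsRoot f p x → IsRoot f′ p (⟦ g ⟧ x)
  root-map {C = C} f g f′ gf≐f′ p x root = begin
    eval C (mapₚ f′ p) (⟦ g ⟧ x)           ≈⟨ eval-map-cong (g ∘ᵣ f) f′ gf≐f′ p _ ⟨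
    eval C (mapₚ (g ∘ᵣ f) p) (⟦ g ⟧ x)     ≡⟨ ≡.cong (λ q → eval C q (⟦ g ⟧ x)) (map-∘ p) ⟩
    eval C (mapₚ g (mapₚ f p)) (⟦ g ⟧ x)   ≈⟨ PolyMap.map-eval g (mapₚ f p) x ⟨
    ⟦ g ⟧ (eval _ (mapₚ f p) x)            ≈⟨ Hom.⟦⟧-cong g root ⟩
    ⟦ g ⟧ _                                ≈⟨ Hom.0#-homo g ⟩
    0#                                     ∎
    where
    open CommutativeRing C
    open SetoidReasoning setoid

  root-lifts : ∀ {ℓ} {k E L : CRing ℓ} (f : k ⟶ E) (j : E ⟶ L) → IsField L → ∀ p →
    Splits E (mapₚ f p) → ∀ y → IsRoot (j ∘ᵣ f) p y → ∃[ e ] (L ∋ ⟦ j ⟧ e ≈ y)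
  root-lifts {E = E} {L} f j isField p (xs , splits) y root =
    PolyMap.root-of-linearProduct j isField xs y (begin
      eval L (mapₚ j (linearProduct E xs)) y  ≈⟨ PolyLemmas.eval-cong L (mapₚ j (mapₚ f p)) (mapₚ j (linearProduct E xs))
                                                   (PolyMap.map-cong j (mapₚ f p) (linearProduct E xs) splits) y ⟨
      eval L (mapₚ j (mapₚ f p)) y            ≡⟨ ≡.cong (λ q → eval L q y) (map-∘ p) ⟨
      eval L (mapₚ (j ∘ᵣ f) p) y              ≈⟨ root ⟩
      0#                                      ∎)
    where
    open CommutativeRing L
    open SetoidReasoning setoid

  factor-injection : ∀ {ℓ} {A B C : CRing ℓ} (j : B ⟶ C) → Injective j → (h : A ⟶ C) →
    (∀ a → ∃[ b ] (C ∋ ⟦ j ⟧ b ≈ ⟦ h ⟧ a)) → Σ[ f ∈ (A ⟶ B) ] (j ∘ᵣ f ≐ h)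
  factor-injection {A = A} {B} {C} j inj h lift =
    homomorphism A B f
      (λ x≈y → inj (trans (jf _) (trans (H.⟦⟧-cong x≈y) (sym (jf _)))))
      (λ x y → inj (trans (jf _) (trans (H.+-homo x y)
        (sym (trans (J.+-homo _ _) (+-cong (jf x) (jf y)))))))
      (λ x y → inj (trans (jf _) (trans (H.*-homo x y)
        (sym (trans (J.*-homo _ _) (*-cong (jf x) (jf y)))))))
      (inj (trans (jf _) (trans H.1#-homo (sym J.1#-homo))))
    , jf
    where
    open CommutativeRing C
    module J = Hom j
    module H = Hom h
    f  = λ a → proj₁ (lift a)
    jf = λ a → proj₂ (lift a)

  factor-surjection : ∀ {ℓ} {A B C : CRing ℓ} (π : A ⟶ B) → Surjective π → (h : A ⟶ C) →
    (∀ {x y} → B ∋ ⟦ π ⟧ x ≈ ⟦ π ⟧ y → C ∋ ⟦ h ⟧ x ≈ ⟦ h ⟧ y) → Σ[ f ∈ (B ⟶ C) ] (f ∘ᵣ π ≐ h)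
  factor-surjection {A = A} {B} {C} π surj h resp =
    homomorphism B C (λ b → ⟦ h ⟧ (s b))
      (λ x≈y → resp (B.trans (πs _) (B.trans x≈y (B.sym (πs _)))))
      (λ x y → C.trans (resp (B.trans (πs _) (B.sym (B.trans (Π.+-homo _ _) (B.+-cong (πs x) (πs y))))))
        (H.+-homo _ _))
      (λ x y → C.trans (resp (B.trans (πs _) (B.sym (B.trans (Π.*-homo _ _) (B.*-cong (πs x) (πs y))))))
        (H.*-homo _ _))
      (C.trans (resp (B.trans (πs _) (B.sym Π.1#-homo))) H.1#-homo)
    , λ x → resp (πs _)
    where
    module B = CommutativeRing B
    module C = CommutativeRing C
    module Π = Hom π
    module H = Hom h
    s  = λ b → proj₁ (surj b)
    πs = λ b → proj₂ (surj b)

  injective-nonzero : ∀ {ℓ} {A B : CRing ℓ} (f : A ⟶ B) → Injective f →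
    ∀ {x} → A ∋ x ≉ CommutativeRing.0# A → B ∋ ⟦ f ⟧ x ≉ CommutativeRing.0# B
  injective-nonzero {B = B} f inj x≉0 fx≈0 = x≉0 (inj (B.trans fx≈0 (B.sym (Hom.0#-homo f))))
    where module B = CommutativeRing B

  extend-fractions : ∀ {ℓ} {A K L : CRing ℓ} (j : A ⟶ K) → IsFractionField j →
    IsField L → (h : A ⟶ L) → Injective h → Σ[ f ∈ (K ⟶ L) ] (f ∘ᵣ j ≐ h)
  extend-fractions {A = A} {K} {L} j (K-field , j-inj , frac) L-field h h-inj =
    homomorphism K L f f-cong f-+ f-*
      (trans (f-j A.1# K.1# J.1#-homo) H.1#-homo) ,
    λ a → f-j a (⟦ j ⟧ a) K.refl
    where
    module A = CommutativeRing A
    module K = CommutativeRing K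
    module J = Hom j
    module H = Hom h
    open CommutativeRing L
    open SetoidReasoning setoid
    module L = Field L L-field

    num : ∣ K ∣ → ∣ A ∣
    num x = proj₁ (frac x)
    den : ∣ K ∣ → ∣ A ∣
    den x = proj₁ (proj₂ (frac x))
    den≉0 : ∀ x → den x A.≉ A.0#
    den≉0 x = proj₁ (proj₂ (proj₂ (frac x)))
    x·den : ∀ x → x K.* ⟦ j ⟧ (den x) K.≈ ⟦ j ⟧ (num x)
    x·den x = proj₂ (proj₂ (proj₂ (frac x)))
    hden≉0 : ∀ x → ⟦ h ⟧ (den x) ≉ 0#
    hden≉0 x = injective-nonzero h h-inj (den≉0 x)

    f : ∣ K ∣ → ∣ L ∣
    f x = ⟦ h ⟧ (num x) * proj₁ (L.inverse (hden≉0 x))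

    f·den : ∀ x → f x * ⟦ h ⟧ (den x) ≈ ⟦ h ⟧ (num x)
    f·den x = begin
      ⟦ h ⟧ (num x) * i * ⟦ h ⟧ (den x)    ≈⟨ *-assoc _ i _ ⟩
      ⟦ h ⟧ (num x) * (i * ⟦ h ⟧ (den x))  ≈⟨ *-congˡ (trans (*-comm i _) (proj₂ (L.inverse (hden≉0 x)))) ⟩
      ⟦ h ⟧ (num x) * 1#                   ≈⟨ *-identityʳ _ ⟩
      ⟦ h ⟧ (num x)                        ∎
      where i = proj₁ (L.inverse (hden≉0 x))

    any-fraction : ∀ x a b → x K.* ⟦ j ⟧ b K.≈ ⟦ j ⟧ a → f x * ⟦ h ⟧ b ≈ ⟦ h ⟧ a
    any-fraction x a b xb≈a = L.cancelʳ (hden≉0 x) (begin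
      f x * ⟦ h ⟧ b * ⟦ h ⟧ (den x)    ≈⟨ *-assoc (f x) _ _ ⟩
      f x * (⟦ h ⟧ b * ⟦ h ⟧ (den x))  ≈⟨ *-congˡ (*-comm _ _) ⟩
      f x * (⟦ h ⟧ (den x) * ⟦ h ⟧ b)  ≈⟨ *-assoc (f x) _ _ ⟨
      f x * ⟦ h ⟧ (den x) * ⟦ h ⟧ b    ≈⟨ *-congʳ (f·den x) ⟩
      ⟦ h ⟧ (num x) * ⟦ h ⟧ b          ≈⟨ H.*-homo _ b ⟨
      ⟦ h ⟧ (num x A.* b)              ≈⟨ H.⟦⟧-cong (j-inj cross) ⟩
      ⟦ h ⟧ (a A.* den x)              ≈⟨ H.*-homo a _ ⟩
      ⟦ h ⟧ a * ⟦ h ⟧ (den x)          ∎)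
      where
      cross : ⟦ j ⟧ (num x A.* b) K.≈ ⟦ j ⟧ (a A.* den x)
      cross = K.trans (J.*-homo _ b) (K.trans (K.*-congʳ (K.sym (x·den x)))
        (K.trans (K.*-assoc x _ _) (K.trans (K.*-congˡ (K.*-comm _ _))
        (K.trans (K.sym (K.*-assoc x _ _)) (K.trans (K.*-congʳ xb≈a) (K.sym (J.*-homo a _)))))))

    f-cong : ∀ {x y} → x K.≈ y → f x ≈ f y
    f-cong {x} {y} x≈y = L.cancelʳ (hden≉0 y)
      (trans (any-fraction x (num y) (den y) (K.trans (K.*-congʳ x≈y) (x·den y))) (sym (f·den y)))

    f-j : ∀ a x → ⟦ j ⟧ a K.≈ x → f x ≈ ⟦ h ⟧ a
    f-j a x ja≈x = begin
      f x                 ≈⟨ *-identityʳ _ ⟨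
      f x * 1#            ≈⟨ *-congˡ H.1#-homo ⟨
      f x * ⟦ h ⟧ A.1#    ≈⟨ any-fraction x a A.1# (K.trans (K.*-congˡ J.1#-homo) (K.trans (K.*-identityʳ x) (K.sym ja≈x))) ⟩
      ⟦ h ⟧ a             ∎

    f-* : ∀ x y → f (x K.* y) ≈ f x * f y
    f-* x y = L.cancelʳ (L.nonzero-* (hden≉0 x) (hden≉0 y)) (begin
      f (x K.* y) * (⟦ h ⟧ (den x) * ⟦ h ⟧ (den y))    ≈⟨ *-congˡ (H.*-homo _ _) ⟨
      f (x K.* y) * ⟦ h ⟧ (den x A.* den y)            ≈⟨ any-fraction (x K.* y) (num x A.* num y) (den x A.* den y) xy·den ⟩
      ⟦ h ⟧ (num x A.* num y)                          ≈⟨ H.*-homo _ _ ⟩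
      ⟦ h ⟧ (num x) * ⟦ h ⟧ (num y)                    ≈⟨ *-cong (f·den x) (f·den y) ⟨
      (f x * ⟦ h ⟧ (den x)) * (f y * ⟦ h ⟧ (den y))    ≈⟨ interchange _ _ _ _ ⟩
      (f x * f y) * (⟦ h ⟧ (den x) * ⟦ h ⟧ (den y))    ∎)
      where
      open CommutativeSemigroupProperties *-commutativeSemigroup using (interchange)
      module KP = CommutativeSemigroupProperties K.*-commutativeSemigroup
      xy·den : (x K.* y) K.* ⟦ j ⟧ (den x A.* den y) K.≈ ⟦ j ⟧ (num x A.* num y)
      xy·den = K.trans (K.*-congˡ (J.*-homo _ _)) (K.trans (KP.interchange x y _ _)
        (K.trans (K.*-cong (x·den x) (x·den y)) (K.sym (J.*-homo _ _))))

    f-+ : ∀ x y → f (x K.+ y) ≈ f x + f y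
    f-+ x y = L.cancelʳ (L.nonzero-* (hden≉0 x) (hden≉0 y)) (begin
      f (x K.+ y) * (⟦ h ⟧ (den x) * ⟦ h ⟧ (den y))
        ≈⟨ *-congˡ (H.*-homo _ _) ⟨
      f (x K.+ y) * ⟦ h ⟧ (den x A.* den y)
        ≈⟨ any-fraction (x K.+ y) (num x A.* den y A.+ num y A.* den x) (den x A.* den y) sum·den ⟩
      ⟦ h ⟧ (num x A.* den y A.+ num y A.* den x)
        ≈⟨ trans (H.+-homo _ _) (+-cong (H.*-homo _ _) (H.*-homo _ _)) ⟩
      ⟦ h ⟧ (num x) * ⟦ h ⟧ (den y) + ⟦ h ⟧ (num y) * ⟦ h ⟧ (den x)
        ≈⟨ +-cong (*-congʳ (f·den x)) (*-congʳ (f·den y)) ⟨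
      f x * ⟦ h ⟧ (den x) * ⟦ h ⟧ (den y) + f y * ⟦ h ⟧ (den y) * ⟦ h ⟧ (den x)
        ≈⟨ +-cong (*-assoc (f x) _ _) (trans (*-assoc (f y) _ _) (*-congˡ (*-comm _ _))) ⟩
      f x * (⟦ h ⟧ (den x) * ⟦ h ⟧ (den y)) + f y * (⟦ h ⟧ (den x) * ⟦ h ⟧ (den y))
        ≈⟨ distribʳ _ (f x) (f y) ⟨
      (f x + f y) * (⟦ h ⟧ (den x) * ⟦ h ⟧ (den y)) ∎)
      where
      sum·den : (x K.+ y) K.* ⟦ j ⟧ (den x A.* den y) K.≈ ⟦ j ⟧ (num x A.* den y A.+ num y A.* den x)
      sum·den = K.trans (K.*-congˡ (J.*-homo _ _)) (K.trans (K.distribʳ _ x y)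
        (K.trans (K.+-cong
          (K.trans (K.sym (K.*-assoc x _ _)) (K.*-congʳ (x·den x)))
          (K.trans (K.*-congˡ (K.*-comm _ _)) (K.trans (K.sym (K.*-assoc y _ _)) (K.*-congʳ (x·den y)))))
        (K.trans (K.+-cong (K.sym (J.*-homo _ _)) (K.sym (J.*-homo _ _))) (K.sym (J.+-homo _ _)))))

  field-injective : ∀ {ℓ} {E L : CRing ℓ} (f : E ⟶ L) → IsField E → IsField L → Injective f
  field-injective {E = E} {L} f E-field L-field {x} {y} fx≈fy with proj₂ E-field (x E.- y)
    where module E = CommutativeRing E
  ... | inj₁ x-y≈0 = x∙y⁻¹≈ε⇒x≈y x y x-y≈0
    where open GroupProperties (CommutativeRing.+-group E) using (x∙y⁻¹≈ε⇒x≈y)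
  ... | inj₂ u = ⊥-elim (Field.unit-nonzero L L-field (unit-map f u)
    (L.trans (Hom.+-homo f x _) (L.trans (L.+-cong fx≈fy (Hom.-‿homo f y)) (L.-‿inverseʳ _))))
    where module L = CommutativeRing L

  fraction-unique : ∀ {ℓ} {A K L : CRing ℓ} (j : A ⟶ K) → IsFractionField j → IsField L →
    (f f′ : K ⟶ L) → f ∘ᵣ j ≐ f′ ∘ᵣ j → f ≐ f′
  fraction-unique {K = K} {L} j (K-field , j-inj , frac) L-field f f′ eq x with frac x
  ... | a , b , b≉0 , xb≈a = Field.cancelʳ L L-field fb≉0 (begin
    ⟦ f ⟧ x * ⟦ f ⟧ (⟦ j ⟧ b)     ≈⟨ Hom.*-homo f x _ ⟨
    ⟦ f ⟧ (x K.* ⟦ j ⟧ b)         ≈⟨ Hom.⟦⟧-cong f xb≈a ⟩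
    ⟦ f ⟧ (⟦ j ⟧ a)               ≈⟨ eq a ⟩
    ⟦ f′ ⟧ (⟦ j ⟧ a)              ≈⟨ Hom.⟦⟧-cong f′ xb≈a ⟨
    ⟦ f′ ⟧ (x K.* ⟦ j ⟧ b)        ≈⟨ Hom.*-homo f′ x _ ⟩
    ⟦ f′ ⟧ x * ⟦ f′ ⟧ (⟦ j ⟧ b)   ≈⟨ *-congˡ (eq b) ⟨
    ⟦ f′ ⟧ x * ⟦ f ⟧ (⟦ j ⟧ b)    ∎)
    where
    module K = CommutativeRing K
    open CommutativeRing L
    open SetoidReasoning setoid
    fb≉0 : ⟦ f ⟧ (⟦ j ⟧ b) ≉ 0#
    fb≉0 = Field.unit-nonzero L L-field
      (unit-map f (Field.inverse K K-field (injective-nonzero j j-inj b≉0)))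

  -- Evaluation of the monic polynomial with the given lower coefficients.
  evalMonic : ∀ {ℓ} (A : CRing ℓ) → List ∣ A ∣ → ∣ A ∣ → ∣ A ∣
  evalMonic A cs = eval A (cs ++ CommutativeRing.1# A ∷ [])

  isMonic-++ : ∀ {ℓ} (A : CRing ℓ) cs → IsMonic A (cs ++ CommutativeRing.1# A ∷ [])
  isMonic-++ A []       = 0 , refl , λ { (ℕ.suc m) _ → refl }
    where open CommutativeRing A
  isMonic-++ A (c ∷ cs) with isMonic-++ A cs
  ... | n , lead , above = ℕ.suc n , lead , λ { (ℕ.suc m) (ℕ.s≤s n<m) → above m n<m }

  lowerCoefficients : ∀ {ℓ} (A : CRing ℓ) p → IsMonic A p →
    ∃[ cs ] EqualPoly A p (cs ++ CommutativeRing.1# A ∷ [])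
  lowerCoefficients A p (n , lead , above) = go n p lead above
    where
    open CommutativeRing A
    go : ∀ n p → coeff A p n ≈ 1# → (∀ m → n ℕ.< m → coeff A p m ≈ 0#) →
         ∃[ cs ] EqualPoly A p (cs ++ 1# ∷ [])
    go ℕ.zero p lead above = [] , λ { ℕ.zero → lead ; (ℕ.suc m) → above (ℕ.suc m) (ℕ.s≤s ℕ.z≤n) }
    go (ℕ.suc n) [] lead above with go n [] lead (λ m _ → refl)
    ... | cs , eq = 0# ∷ cs , λ { ℕ.zero → refl ; (ℕ.suc m) → eq m }
    go (ℕ.suc n) (a ∷ p) lead above with go n p lead (λ m n<m → above (ℕ.suc m) (ℕ.s≤s n<m))
    ... | cs , eq = a ∷ cs , λ { ℕ.zero → refl ; (ℕ.suc m) → eq m }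

  -- The integral closure of O in an algebraic extension of Frac O has that
  -- extension as its field of fractions.
  module _ {ℓ} {O K F C : CRing ℓ} (j : O ⟶ K) (j-frac : IsFractionField j)
           (f : K ⟶ F) (F-field : IsField F) (c : C ⟶ F) (closure : IsIntegralClosure (f ∘ᵣ j) c) where
    private
      module O = CommutativeRing O
      module K = CommutativeRing K
      module C = CommutativeRing C
      g : O ⟶ F
      g = f ∘ᵣ j
    open CommutativeRing F
    open SetoidReasoning setoid

    common-denominator : ∀ cs → ∃[ d ] (O ∋ d ≉ O.0# × All (λ x → ∃[ a ] (K ∋ ⟦ j ⟧ d K.* x ≈ ⟦ j ⟧ a)) cs)
    common-denominator [] = O.1# , 1≉0 , []
      where
      1≉0 : O ∋ O.1# ≉ O.0#
      1≉0 eq = proj₁ (proj₁ j-frac) (K.trans (K.sym (Hom.1#-homo j)) (K.trans (Hom.⟦⟧-cong j eq) (Hom.0#-homo j)))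
    common-denominator (x ∷ cs) with proj₂ (proj₂ j-frac) x | common-denominator cs
    ... | a , b , b≉0 , xb≈a | d , d≉0 , ds = b O.* d , bd≉0 ,
      (d O.* a , first) ∷ All.map (λ {y} (a′ , eq) → b O.* a′ , rest y a′ eq) ds
      where
      j-nonzero : ∀ {y} → O ∋ y ≉ O.0# → K ∋ ⟦ j ⟧ y ≉ K.0#
      j-nonzero = injective-nonzero j (proj₁ (proj₂ j-frac))
      bd≉0 : O ∋ b O.* d ≉ O.0#
      bd≉0 eq = Field.nonzero-* K (proj₁ j-frac) (j-nonzero b≉0) (j-nonzero d≉0)
        (K.trans (K.sym (Hom.*-homo j b d)) (K.trans (Hom.⟦⟧-cong j eq) (Hom.0#-homo j)))
      first : K ∋ ⟦ j ⟧ (b O.* d) K.* x ≈ ⟦ j ⟧ (d O.* a)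
      first = K.trans (K.*-congʳ (K.trans (Hom.⟦⟧-cong j (O.*-comm b d)) (Hom.*-homo j d b)))
        (K.trans (K.*-assoc _ _ x) (K.trans (K.*-congˡ (K.trans (K.*-comm _ x) xb≈a)) (K.sym (Hom.*-homo j d a))))
      rest : ∀ y a′ → K ∋ ⟦ j ⟧ d K.* y ≈ ⟦ j ⟧ a′ → K ∋ ⟦ j ⟧ (b O.* d) K.* y ≈ ⟦ j ⟧ (b O.* a′)
      rest y a′ eq = K.trans (K.*-congʳ (Hom.*-homo j b d))
        (K.trans (K.*-assoc _ _ y) (K.trans (K.*-congˡ eq) (K.sym (Hom.*-homo j b a′))))

    -- If x is a root of Xⁿ + … + cᵢ Xⁱ + … then d x is a root of
    -- Xⁿ + … + dⁿ⁻ⁱ cᵢ Xⁱ + … .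
    scale-root : ∀ d x cs → All (λ y → ∃[ a ] (K ∋ ⟦ j ⟧ d K.* y ≈ ⟦ j ⟧ a)) cs →
      ∃[ bs ] ∃[ e ] (eval F (mapₚ g (bs ++ O.1# ∷ [])) (⟦ g ⟧ d * x) ≈
                      ⟦ g ⟧ e * eval F (mapₚ f (cs ++ K.1# ∷ [])) x)
    scale-root d x [] [] = [] , O.1# , (begin
      ⟦ g ⟧ O.1# + ⟦ g ⟧ d * x * 0#          ≈⟨ +-congˡ (zeroʳ _) ⟩
      ⟦ g ⟧ O.1# + 0#                        ≈⟨ +-cong (Hom.1#-homo g) (sym (zeroʳ x)) ⟩
      1# + x * 0#                            ≈⟨ +-congʳ (Hom.1#-homo f) ⟨
      ⟦ f ⟧ K.1# + x * 0#                    ≈⟨ *-identityˡ _ ⟨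
      1# * (⟦ f ⟧ K.1# + x * 0#)             ≈⟨ *-congʳ (Hom.1#-homo g) ⟨
      ⟦ g ⟧ O.1# * (⟦ f ⟧ K.1# + x * 0#)     ∎)
    scale-root d x (y ∷ cs) ((a , dy≈a) ∷ ds) with scale-root d x cs ds
    ... | bs , e , eq = e O.* a ∷ bs , d O.* e , (begin
      ⟦ g ⟧ (e O.* a) + ⟦ g ⟧ d * x * B                            ≈⟨ +-cong head (*-congˡ eq) ⟩
      ⟦ g ⟧ (d O.* e) * ⟦ f ⟧ y + ⟦ g ⟧ d * x * (⟦ g ⟧ e * P)      ≈⟨ +-congˡ (interchange _ x _ P) ⟩
      ⟦ g ⟧ (d O.* e) * ⟦ f ⟧ y + ⟦ g ⟧ d * ⟦ g ⟧ e * (x * P)      ≈⟨ +-congˡ (*-congʳ (Hom.*-homo g d e)) ⟨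
      ⟦ g ⟧ (d O.* e) * ⟦ f ⟧ y + ⟦ g ⟧ (d O.* e) * (x * P)        ≈⟨ distribˡ _ _ _ ⟨
      ⟦ g ⟧ (d O.* e) * (⟦ f ⟧ y + x * P)                          ∎)
      where
      open CommutativeSemigroupProperties *-commutativeSemigroup using (interchange)
      B = eval F (mapₚ g (bs ++ O.1# ∷ [])) (⟦ g ⟧ d * x)
      P = eval F (mapₚ f (cs ++ K.1# ∷ [])) x
      head : ⟦ g ⟧ (e O.* a) ≈ ⟦ g ⟧ (d O.* e) * ⟦ f ⟧ y
      head = begin
        ⟦ g ⟧ (e O.* a)                    ≈⟨ Hom.*-homo g e a ⟩
        ⟦ g ⟧ e * ⟦ g ⟧ a                  ≈⟨ *-congˡ (Hom.⟦⟧-cong f dy≈a) ⟨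
        ⟦ g ⟧ e * ⟦ f ⟧ (⟦ j ⟧ d K.* y)    ≈⟨ *-congˡ (Hom.*-homo f _ y) ⟩
        ⟦ g ⟧ e * (⟦ g ⟧ d * ⟦ f ⟧ y)      ≈⟨ *-assoc _ _ _ ⟨
        ⟦ g ⟧ e * ⟦ g ⟧ d * ⟦ f ⟧ y        ≈⟨ *-congʳ (trans (*-comm _ _) (sym (Hom.*-homo g d e))) ⟩
        ⟦ g ⟧ (d O.* e) * ⟦ f ⟧ y          ∎

    scalar-integral : ∀ d → ∃[ a ] (⟦ c ⟧ a ≈ ⟦ g ⟧ d)
    scalar-integral d = Equivalence.to (proj₂ closure (⟦ g ⟧ d))
      (O.- d ∷ O.1# ∷ [] , isMonic-++ O (O.- d ∷ []) , (begin
        ⟦ g ⟧ (O.- d) + ⟦ g ⟧ d * (⟦ g ⟧ O.1# + ⟦ g ⟧ d * 0#)  ≈⟨ +-cong (Hom.-‿homo g d) (*-congˡ (trans (+-cong (Hom.1#-homo g) (zeroʳ _)) (+-identityʳ 1#))) ⟩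
        - ⟦ g ⟧ d + ⟦ g ⟧ d * 1#                               ≈⟨ +-congˡ (*-identityʳ _) ⟩
        - ⟦ g ⟧ d + ⟦ g ⟧ d                                    ≈⟨ -‿inverseˡ _ ⟩
        0#                                                     ∎))

    closure-fractions : (∀ x → ∃[ p ] (IsMonic K p × IsRoot f p x)) → IsFractionField c
    closure-fractions algebraic = F-field , proj₁ closure , frac
      where
      frac : ∀ x → ∃[ a ] ∃[ b ] ((C ∋ b ≉ C.0#) × x * ⟦ c ⟧ b ≈ ⟦ c ⟧ a)
      frac x with algebraic x
      ... | p , monic , root with lowerCoefficients K p monic
      ... | cs , p≈cs with common-denominator cs
      ... | d , d≉0 , ds with scale-root d x cs ds
      ... | bs , e , eq with Equivalence.to (proj₂ closure (⟦ g ⟧ d * x))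
              (bs ++ O.1# ∷ [] , isMonic-++ O bs , (begin
                eval F (mapₚ g (bs ++ O.1# ∷ [])) (⟦ g ⟧ d * x)      ≈⟨ eq ⟩
                ⟦ g ⟧ e * eval F (mapₚ f (cs ++ K.1# ∷ [])) x        ≈⟨ *-congˡ (PolyLemmas.eval-cong F (mapₚ f p) (mapₚ f (cs ++ K.1# ∷ [])) (PolyMap.map-cong f p (cs ++ K.1# ∷ []) p≈cs) x) ⟨
                ⟦ g ⟧ e * eval F (mapₚ f p) x                        ≈⟨ *-congˡ root ⟩
                ⟦ g ⟧ e * 0#                                         ≈⟨ zeroʳ _ ⟩
                0#                                                   ∎))
         | scalar-integral d
      ... | a , ca≈dx | b , cb≈d = a , b , b≉0 , trans (*-congˡ cb≈d) (trans (*-comm x _) (sym ca≈dx))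
        where
        b≉0 : C ∋ b ≉ C.0#
        b≉0 b≈0 = injective-nonzero j (proj₁ (proj₂ j-frac)) d≉0
          (field-injective f (proj₁ j-frac) F-field
            (trans (sym cb≈d) (trans (Hom.⟦⟧-cong c b≈0) (trans (Hom.0#-homo c) (sym (Hom.0#-homo f))))))

  residue-respects : ∀ {ℓ} {A k κ : CRing ℓ} (π : A ⟶ k) → IsResidueField π → IsField κ →
    (h : A ⟶ κ) → (∀ x → IsUnit κ (⟦ h ⟧ x) → IsUnit A x) →
    ∀ {x y} → k ∋ ⟦ π ⟧ x ≈ ⟦ π ⟧ y → κ ∋ ⟦ h ⟧ x ≈ ⟦ h ⟧ y
  residue-respects {A = A} {k} {κ} π (k-field , _ , _) κ-field h reflect {x} {y} πx≈πy
    with proj₂ κ-field (⟦ h ⟧ (x A.- y))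
    where module A = CommutativeRing A
  ... | inj₂ u = ⊥-elim (Field.unit-nonzero k k-field (unit-map π (reflect _ u)) (begin
    ⟦ π ⟧ (x A.- y)               ≈⟨ trans (Π.+-homo x _) (+-congˡ (Π.-‿homo y)) ⟩
    ⟦ π ⟧ x + - ⟦ π ⟧ y           ≈⟨ +-congʳ πx≈πy ⟩
    ⟦ π ⟧ y + - ⟦ π ⟧ y           ≈⟨ -‿inverseʳ _ ⟩
    0#                            ∎))
    where
    module A = CommutativeRing A
    module Π = Hom π
    open CommutativeRing k
    open SetoidReasoning setoid
  ... | inj₁ hd≈0 = x∙y⁻¹≈ε⇒x≈y (⟦ h ⟧ x) (⟦ h ⟧ y)
    (trans (sym (trans (H.+-homo x _) (+-congˡ (H.-‿homo y)))) hd≈0)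
    where
    module H = Hom h
    open CommutativeRing κ
    open GroupProperties +-group using (x∙y⁻¹≈ε⇒x≈y)

EndRing : ∀ {ℓ} → CRing ℓ → RawMonoid ℓ ℓ
EndRing A = record { Carrier = A ⟶ A ; _≈_ = _≐_ ; _∙_ = _∘ᵣ_ ; ε = idᵣ }

RingAction : ∀ {g g′ ℓ} → Group g g′ → CRing ℓ → Set (g ⊔ g′ ⊔ ℓ)
RingAction G A = MonoidHomomorphism (Group.rawMonoid G) (EndRing A)

module _ {g g′ ℓ : Level} (Γ : Group g g′) where
  open Group Γ using (_∙_; ε; _⁻¹; inverseˡ) renaming (Carrier to ∣Γ∣; _≈_ to _≈ᵞ_)
  private module Act {A : CRing ℓ} (ρ : RingAction Γ A) = MonoidHomomorphism ρ

  Equivariant : {A B : CRing ℓ} → RingAction Γ A → RingAction Γ B → A ⟶ B → Set (g ⊔ ℓ)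
  Equivariant ρᴬ ρᴮ f = ∀ γ → f ∘ᵣ Act.⟦_⟧ ρᴬ γ ≐ Act.⟦_⟧ ρᴮ γ ∘ᵣ f

  private
    act-inverse : {A : CRing ℓ} (ρ : RingAction Γ A) → ∀ γ → Act.⟦_⟧ ρ (γ ⁻¹) ∘ᵣ Act.⟦_⟧ ρ γ ≐ idᵣ
    act-inverse {A} ρ γ x = A.trans (A.sym (Act.homo ρ (γ ⁻¹) γ x))
      (A.trans (Act.⟦⟧-cong ρ (inverseˡ γ) x) (Act.ε-homo ρ x))
      where module A = CommutativeRing A

    act-injective : {A : CRing ℓ} (ρ : RingAction Γ A) → ∀ γ → Injective (Act.⟦_⟧ ρ γ)
    act-injective {A} ρ γ {x} {y} γx≈γy = A.trans (A.sym (act-inverse ρ γ x))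
      (A.trans (Hom.⟦⟧-cong (Act.⟦_⟧ ρ (γ ⁻¹)) γx≈γy) (act-inverse ρ γ y))
      where module A = CommutativeRing A

    act-local : {A : CRing ℓ} (ρ : RingAction Γ A) → ∀ γ → IsLocalHomomorphism (Act.⟦_⟧ ρ γ)
    act-local {A} ρ γ x u with unit-map (Act.⟦_⟧ ρ (γ ⁻¹)) u
    ... | y , eq = y , A.trans (A.*-congʳ (A.sym (act-inverse ρ γ x))) eq
      where module A = CommutativeRing A

    action-by-uniqueness : ∀ {p} {A : CRing ℓ} (P : ∣Γ∣ → A ⟶ A → Set p) →
      (lift : ∀ γ → ∃ (P γ)) →
      (∀ γ f f′ → P γ f → P γ f′ → f ≐ f′) →
      (∀ {γ δ f} → γ ≈ᵞ δ → P γ f → P δ f) → P ε idᵣ →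
      (∀ {γ δ f f′} → P γ f → P δ f′ → P (γ ∙ δ) (f ∘ᵣ f′)) → RingAction Γ A
    action-by-uniqueness P lift unique resp P-ε P-∙ = record
      { ⟦_⟧ = λ γ → proj₁ (lift γ)
      ; isMonoidHomomorphism = record
        { isMagmaHomomorphism = record
          { isRelHomomorphism = record
            { cong = λ {γ} {δ} γ≈δ → unique δ _ _ (resp γ≈δ (proj₂ (lift _))) (proj₂ (lift _)) }
          ; homo = λ γ δ → unique (γ ∙ δ) _ _ (proj₂ (lift _)) (P-∙ (proj₂ (lift γ)) (proj₂ (lift δ))) }
        ; ε-homo = unique ε _ _ (proj₂ (lift ε)) P-ε } }

  restrict-action : {A B : CRing ℓ} (ρ : RingAction Γ B) (j : A ⟶ B) → Injective j →
    (∀ γ a → ∃[ a′ ] (B ∋ ⟦ j ⟧ a′ ≈ ⟦ Act.⟦_⟧ ρ γ ⟧ (⟦ j ⟧ a))) →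
    Σ[ ρᴬ ∈ RingAction Γ A ] Equivariant ρᴬ ρ j
  restrict-action {A} {B} ρ j inj stable =
    action-by-uniqueness (λ γ f → j ∘ᵣ f ≐ Act.⟦_⟧ ρ γ ∘ᵣ j) lift
      (λ γ f f′ p q x → inj (trans (p x) (sym (q x))))
      (λ γ≈δ p x → trans (p x) (Act.⟦⟧-cong ρ γ≈δ _))
      (λ x → sym (Act.ε-homo ρ _))
      (λ {γ} {δ} p q x → trans (p _) (trans (Hom.⟦⟧-cong (Act.⟦_⟧ ρ γ) (q x)) (sym (Act.homo ρ γ δ _))))
    , λ γ → proj₂ (lift γ)
    where
    open CommutativeRing B using (trans; sym)
    lift : ∀ γ → Σ[ f ∈ (A ⟶ A) ] (j ∘ᵣ f ≐ Act.⟦_⟧ ρ γ ∘ᵣ j)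
    lift γ = factor-injection j inj (Act.⟦_⟧ ρ γ ∘ᵣ j) (stable γ)

  private
    extend-action : {A B : CRing ℓ} (ρ : RingAction Γ A) (i : A ⟶ B) →
      ((f f′ : B ⟶ B) → f ∘ᵣ i ≐ f′ ∘ᵣ i → f ≐ f′) →
      (∀ γ → Σ[ f ∈ (B ⟶ B) ] (f ∘ᵣ i ≐ i ∘ᵣ Act.⟦_⟧ ρ γ)) →
      Σ[ ρᴮ ∈ RingAction Γ B ] Equivariant ρ ρᴮ i
    extend-action {A} {B} ρ i epi lift =
      action-by-uniqueness (λ γ f → f ∘ᵣ i ≐ i ∘ᵣ Act.⟦_⟧ ρ γ) lift
        (λ γ f f′ p q → epi f f′ (λ x → trans (p x) (sym (q x))))
        (λ γ≈δ p x → trans (p x) (Hom.⟦⟧-cong i (Act.⟦⟧-cong ρ γ≈δ x)))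
        (λ x → sym (Hom.⟦⟧-cong i (Act.ε-homo ρ x)))
        (λ {γ} {δ} {f} p q x → trans (Hom.⟦⟧-cong f (q x)) (trans (p _) (sym (Hom.⟦⟧-cong i (Act.homo ρ γ δ x)))))
      , λ γ x → sym (proj₂ (lift γ) x)
      where open CommutativeRing B using (trans; sym)

  residue-action : {A k : CRing ℓ} (ρ : RingAction Γ A) (π : A ⟶ k) → IsResidueField π →
    Σ[ ρᵏ ∈ RingAction Γ k ] Equivariant ρ ρᵏ π
  residue-action {A} {k} ρ π res@(k-field , surj , reflect) = extend-action ρ π
    (λ f f′ eq y → trans (Hom.⟦⟧-cong f (sym (proj₂ (surj y))))
      (trans (eq _) (Hom.⟦⟧-cong f′ (proj₂ (surj y)))))
    (λ γ → factor-surjection π surj (π ∘ᵣ Act.⟦_⟧ ρ γ)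
      (residue-respects π res k-field (π ∘ᵣ Act.⟦_⟧ ρ γ)
        (λ x u → act-local ρ γ x (reflect _ u))))
    where open CommutativeRing k using (trans; sym)

  fraction-action : {A K : CRing ℓ} (ρ : RingAction Γ A) (j : A ⟶ K) → IsFractionField j →
    Σ[ ρᴷ ∈ RingAction Γ K ] Equivariant ρ ρᴷ j
  fraction-action {A} {K} ρ j isFrac@(K-field , j-inj , _) = extend-action ρ j
    (fraction-unique j isFrac K-field)
    (λ γ → extend-fractions j isFrac K-field (j ∘ᵣ Act.⟦_⟧ ρ γ) (λ eq → act-injective ρ γ (j-inj eq)))

  henselisation-action : {A k Aˢʰ k̄ : CRing ℓ} {π : A ⟶ k} {ι : k ⟶ k̄} {i : A ⟶ Aˢʰ} {πˢʰ : Aˢʰ ⟶ k̄} →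
    IsStrictHenselisation π ι i πˢʰ →
    (ρᴬ : RingAction Γ A) (ρᵏ : RingAction Γ k) (ρᵏ̄ : RingAction Γ k̄) →
    Equivariant ρᴬ ρᵏ π → Equivariant ρᵏ ρᵏ̄ ι →
    Σ[ ρˢʰ ∈ RingAction Γ Aˢʰ ] (Equivariant ρᴬ ρˢʰ i × Equivariant ρˢʰ ρᵏ̄ πˢʰ)
  henselisation-action {A} {k} {Aˢʰ} {k̄} {π} {ι} {i} {πˢʰ} isSH ρᴬ ρᵏ ρᵏ̄ π-equiv ι-equiv =
    action-by-uniqueness P lift
      (λ γ f f′ p q x → S.trans (S.sym (proj₂ (proj₂ (ext γ)) {f} p x)) (proj₂ (proj₂ (ext γ)) {f′} q x))
      (λ γ≈δ (l , p , q) → l ,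
        (λ x → S.trans (p x) (Hom.⟦⟧-cong i (Act.⟦⟧-cong ρᴬ γ≈δ x))) ,
        (λ x → k̄.trans (q x) (Act.⟦⟧-cong ρᵏ̄ γ≈δ _)))
      ((λ x u → u) , (λ x → S.sym (Hom.⟦⟧-cong i (Act.ε-homo ρᴬ x))) , (λ x → k̄.sym (Act.ε-homo ρᵏ̄ _)))
      (λ {γ} {δ} {f} {f′} (l , p , q) (l′ , p′ , q′) →
        (λ x u → l′ x (l _ u)) ,
        (λ x → S.trans (Hom.⟦⟧-cong f (p′ x)) (S.trans (p _) (S.sym (Hom.⟦⟧-cong i (Act.homo ρᴬ γ δ x))))) ,
        (λ x → k̄.trans (q _) (k̄.trans (Hom.⟦⟧-cong (Act.⟦_⟧ ρᵏ̄ γ) (q′ x)) (k̄.sym (Act.homo ρᵏ̄ γ δ _)))))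
    , (λ γ x → S.sym (proj₁ (proj₂ (proj₂ (lift γ))) x))
    , (λ γ → proj₂ (proj₂ (proj₂ (lift γ))))
    where
    open IsStrictHenselisation isSH
    module k̄ = CommutativeRing k̄
    module S = CommutativeRing Aˢʰ

    P : ∣Γ∣ → Aˢʰ ⟶ Aˢʰ → Set ℓ
    P γ f = IsLocalHomomorphism f × f ∘ᵣ i ≐ i ∘ᵣ Act.⟦_⟧ ρᴬ γ × πˢʰ ∘ᵣ f ≐ Act.⟦_⟧ ρᵏ̄ γ ∘ᵣ πˢʰ

    ext : ∀ γ → ∃! _≐_ (P γ)
    ext γ = universal πˢʰ isStrictlyHenselian (i ∘ᵣ Act.⟦_⟧ ρᴬ γ)
      (λ x u → act-local ρᴬ γ x (isLocal _ u)) (Act.⟦_⟧ ρᵏ̄ γ)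
      (λ x → k̄.trans (commutes _) (k̄.trans (Hom.⟦⟧-cong ι (π-equiv γ x)) (ι-equiv γ _)))

    lift : ∀ γ → ∃ (P γ)
    lift γ = proj₁ (ext γ) , proj₁ (proj₂ (ext γ))

record AlgebraAutomorphism {ℓ} {k E : CRing ℓ} (f : k ⟶ E) : Set ℓ where
  field
    to      : E ⟶ E
    from    : E ⟶ E
    to-from : to ∘ᵣ from ≐ idᵣ
    from-to : from ∘ᵣ to ≐ idᵣ
    fixes   : to ∘ᵣ f ≐ f

Gal : ∀ {ℓ} {k E : CRing ℓ} → k ⟶ E → Group ℓ ℓ
Gal {E = E} f = record
  { Carrier = AlgebraAutomorphism f
  ; _≈_     = λ α β → to α ≐ to β
  ; _∙_     = λ α β → record
    { to      = to α ∘ᵣ to β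
    ; from    = from β ∘ᵣ from α
    ; to-from = λ x → trans (Hom.⟦⟧-cong (to α) (to-from β _)) (to-from α x)
    ; from-to = λ x → trans (Hom.⟦⟧-cong (from β) (from-to α _)) (from-to β x)
    ; fixes   = λ x → trans (Hom.⟦⟧-cong (to α) (fixes β x)) (fixes α x) }
  ; ε       = record
    { to = idᵣ ; from = idᵣ ; to-from = λ _ → refl ; from-to = λ _ → refl ; fixes = λ _ → refl }
  ; _⁻¹     = λ α → record
    { to      = from α
    ; from    = to α
    ; to-from = from-to α
    ; from-to = to-from α
    ; fixes   = λ x → trans (Hom.⟦⟧-cong (from α) (sym (fixes α x))) (from-to α _) }
  ; isGroup = record
    { isMonoid = record
      { isSemigroup = record
        { isMagma = record
          { isEquivalence = record
            { refl  = λ _ → refl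
            ; sym   = λ p x → sym (p x)
            ; trans = λ p q x → trans (p x) (q x) }
          ; ∙-cong = λ {α} {α′} {β} {β′} p q x → trans (p _) (Hom.⟦⟧-cong (to α′) (q x)) }
        ; assoc = λ _ _ _ _ → refl }
      ; identity = (λ _ _ → refl) , (λ _ _ → refl) }
    ; inverse = from-to , to-from
    ; ⁻¹-cong = λ {α} {β} p x → trans (Hom.⟦⟧-cong (from α)
        (trans (sym (to-from β x)) (sym (p _)))) (from-to α _) }
  }
  where
  open CommutativeRing E using (refl; sym; trans)
  open AlgebraAutomorphism

Gal-action : ∀ {ℓ} {k E : CRing ℓ} (f : k ⟶ E) → RingAction (Gal f) E
Gal-action {E = E} f = record
  { ⟦_⟧ = AlgebraAutomorphism.to
  ; isMonoidHomomorphism = record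
    { isMagmaHomomorphism = record
      { isRelHomomorphism = record { cong = λ p → p }
      ; homo = λ _ _ _ → refl }
    ; ε-homo = λ _ → refl } }
  where open CommutativeRing E using (refl)

-- F is taken inside K̄, and the separable closure k̄F of kF inside the residue
-- field κ of the integral closure OK̄ of O in K̄, so that Gal(K̄/K) acts on both.
-- The homomorphisms OF→OK̄ and F→Fˢʰ are the only ones making their squares
-- commute.
record Setting (ℓ : Level) : Set (suc ℓ) where
  field
    O K k : CRing ℓ
    O→K   : O ⟶ K
    O→k   : O ⟶ k
    O-dvr       : IsDVR O→K
    O-henselian : IsHenselian O→k

    K̄    : CRing ℓ
    K→K̄  : K ⟶ K̄
    K̄-separableClosure : IsSeparableClosure K→K̄

    F    : CRing ℓ
    K→F  : K ⟶ F
    F→K̄  : F ⟶ K̄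
    K→F→K̄    : F→K̄ ∘ᵣ K→F ≐ K→K̄
    F-galois : IsFiniteGalois K→F

    OF   : CRing ℓ
    OF→F : OF ⟶ F
    OF-integralClosure : IsIntegralClosure (K→F ∘ᵣ O→K) OF→F

    kF    : CRing ℓ
    OF→kF : OF ⟶ kF
    kF-residueField : IsResidueField OF→kF

    OK̄    : CRing ℓ
    OK̄→K̄  : OK̄ ⟶ K̄
    OF→OK̄ : OF ⟶ OK̄
    OK̄-integralClosure : IsIntegralClosure (K→K̄ ∘ᵣ O→K) OK̄→K̄
    OF→OK̄→K̄ : OK̄→K̄ ∘ᵣ OF→OK̄ ≐ F→K̄ ∘ᵣ OF→F

    κ     : CRing ℓ
    OK̄→κ  : OK̄ ⟶ κ
    κ-residueField : IsResidueField OK̄→κ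

    k̄F    : CRing ℓ
    kF→k̄F : kF ⟶ k̄F
    k̄F→κ  : k̄F ⟶ κ
    k̄F-separableClosure : IsSeparableClosure kF→k̄F
    OF→kF→κ : (k̄F→κ ∘ᵣ kF→k̄F) ∘ᵣ OF→kF ≐ OK̄→κ ∘ᵣ OF→OK̄

    OFˢʰ     : CRing ℓ
    OF→OFˢʰ  : OF ⟶ OFˢʰ
    OFˢʰ→k̄F  : OFˢʰ ⟶ k̄F
    OFˢʰ-strictHenselisation : IsStrictHenselisation OF→kF kF→k̄F OF→OFˢʰ OFˢʰ→k̄F

    Fˢʰ      : CRing ℓ
    OFˢʰ→Fˢʰ : OFˢʰ ⟶ Fˢʰ
    F→Fˢʰ    : F ⟶ Fˢʰ
    Fˢʰ-fractionField : IsFractionField OFˢʰ→Fˢʰ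
    OF→F→Fˢʰ : F→Fˢʰ ∘ᵣ OF→F ≐ OFˢʰ→Fˢʰ ∘ᵣ OF→OFˢʰ

private
  integral-stable : ∀ {ℓ} {A C R : CRing ℓ} (f : A ⟶ R) (c : C ⟶ R) → IsIntegralClosure f c →
    (γ : R ⟶ R) → γ ∘ᵣ f ≐ f → ∀ y → ∃[ y′ ] (R ∋ ⟦ c ⟧ y′ ≈ ⟦ γ ⟧ (⟦ c ⟧ y))
  integral-stable {R = R} f c (_ , iff) γ γf≐f y
    with Equivalence.from (iff (⟦ c ⟧ y)) (y , CommutativeRing.refl R)
  ... | p , monic , root = Equivalence.to (iff _) (p , monic , root-map f γ f γf≐f p _ root)

-- Each action is the only one for which the homomorphism connecting the ring to
-- an earlier one is equivariant (for OFˢʰ: the homomorphisms from OF and to k̄F);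
-- the constructions are abstract because nothing else about them matters.
module GaloisActions {ℓ} (D : Setting ℓ) where
  open Setting D

  G_K : Group ℓ ℓ
  G_K = Gal K→K̄

  act : {A : CRing ℓ} → RingAction G_K A → Group.Carrier G_K → A ⟶ A
  act ρ = MonoidHomomorphism.⟦_⟧ ρ

  on-K̄ : RingAction G_K K̄
  on-K̄ = Gal-action K→K̄

  private
    K̄-field : IsField K̄
    K̄-field = proj₁ (proj₁ (proj₂ K̄-separableClosure))
    k̄F-sepClosed : IsSeparablyClosed k̄F
    k̄F-sepClosed = proj₁ (proj₂ k̄F-separableClosure)

    F→K̄-injective : Injective F→K̄
    F→K̄-injective = field-injective F→K̄ (proj₁ (proj₂ F-galois)) K̄-field

    fixes : ∀ γ → act on-K̄ γ ∘ᵣ K→K̄ ≐ K→K̄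
    fixes = AlgebraAutomorphism.fixes

    F-stable : ∀ γ x → ∃[ x′ ] (K̄ ∋ ⟦ F→K̄ ⟧ x′ ≈ ⟦ act on-K̄ γ ⟧ (⟦ F→K̄ ⟧ x))
    F-stable γ x with proj₂ (proj₂ (proj₂ F-galois)) x
    ... | p , (_ , _ , root) , _ , splits = root-lifts K→F F→K̄ K̄-field p splits _
      (root-map K→F (act on-K̄ γ ∘ᵣ F→K̄) (F→K̄ ∘ᵣ K→F)
        (λ a → trans (Hom.⟦⟧-cong (act on-K̄ γ) (K→F→K̄ a)) (trans (fixes γ a) (sym (K→F→K̄ a)))) p x root)
      where open CommutativeRing K̄ using (trans; sym)

    abstract
      F-action : Σ[ ρ ∈ RingAction G_K F ] Equivariant G_K ρ on-K̄ F→K̄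
      F-action = restrict-action G_K on-K̄ F→K̄ F→K̄-injective F-stable

  on-F : RingAction G_K F
  on-F = proj₁ F-action

  F→K̄-equivariant : Equivariant G_K on-F on-K̄ F→K̄
  F→K̄-equivariant = proj₂ F-action

  private
    F-fixes : ∀ γ → act on-F γ ∘ᵣ K→F ≐ K→F
    F-fixes γ a = F→K̄-injective (trans (F→K̄-equivariant γ _)
      (trans (Hom.⟦⟧-cong (act on-K̄ γ) (K→F→K̄ a)) (trans (fixes γ a) (sym (K→F→K̄ a)))))
      where open CommutativeRing K̄ using (trans; sym)

    abstract
      OF-action : Σ[ ρ ∈ RingAction G_K OF ] Equivariant G_K ρ on-F OF→F
      OF-action = restrict-action G_K on-F OF→F (proj₁ OF-integralClosure) (λ γ →
        integral-stable (K→F ∘ᵣ O→K) OF→F OF-integralClosure (act on-F γ) (λ a → F-fixes γ _))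

    abstract
      OK̄-action : Σ[ ρ ∈ RingAction G_K OK̄ ] Equivariant G_K ρ on-K̄ OK̄→K̄
      OK̄-action = restrict-action G_K on-K̄ OK̄→K̄ (proj₁ OK̄-integralClosure) (λ γ →
        integral-stable (K→K̄ ∘ᵣ O→K) OK̄→K̄ OK̄-integralClosure (act on-K̄ γ) (λ a → fixes γ _))

  on-OF : RingAction G_K OF
  on-OF = proj₁ OF-action

  OF→F-equivariant : Equivariant G_K on-OF on-F OF→F
  OF→F-equivariant = proj₂ OF-action

  on-OK̄ : RingAction G_K OK̄
  on-OK̄ = proj₁ OK̄-action

  OK̄→K̄-equivariant : Equivariant G_K on-OK̄ on-K̄ OK̄→K̄
  OK̄→K̄-equivariant = proj₂ OK̄-action

  private
    OF→OK̄-equivariant : Equivariant G_K on-OF on-OK̄ OF→OK̄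
    OF→OK̄-equivariant γ x = proj₁ OK̄-integralClosure (begin
      ⟦ OK̄→K̄ ⟧ (⟦ OF→OK̄ ⟧ (⟦ act on-OF γ ⟧ x))    ≈⟨ OF→OK̄→K̄ _ ⟩
      ⟦ F→K̄ ⟧ (⟦ OF→F ⟧ (⟦ act on-OF γ ⟧ x))      ≈⟨ Hom.⟦⟧-cong F→K̄ (OF→F-equivariant γ x) ⟩
      ⟦ F→K̄ ⟧ (⟦ act on-F γ ⟧ (⟦ OF→F ⟧ x))       ≈⟨ F→K̄-equivariant γ _ ⟩
      ⟦ act on-K̄ γ ⟧ (⟦ F→K̄ ⟧ (⟦ OF→F ⟧ x))       ≈⟨ Hom.⟦⟧-cong (act on-K̄ γ) (OF→OK̄→K̄ x) ⟨
      ⟦ act on-K̄ γ ⟧ (⟦ OK̄→K̄ ⟧ (⟦ OF→OK̄ ⟧ x))     ≈⟨ OK̄→K̄-equivariant γ _ ⟨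
      ⟦ OK̄→K̄ ⟧ (⟦ act on-OK̄ γ ⟧ (⟦ OF→OK̄ ⟧ x))    ∎)
      where open SetoidReasoning (CommutativeRing.setoid K̄)

    abstract
      kF-action : Σ[ ρ ∈ RingAction G_K kF ] Equivariant G_K on-OF ρ OF→kF
      kF-action = residue-action G_K on-OF OF→kF kF-residueField
    abstract
      κ-action : Σ[ ρ ∈ RingAction G_K κ ] Equivariant G_K on-OK̄ ρ OK̄→κ
      κ-action = residue-action G_K on-OK̄ OK̄→κ κ-residueField

  on-kF : RingAction G_K kF
  on-kF = proj₁ kF-action

  OF→kF-equivariant : Equivariant G_K on-OF on-kF OF→kF
  OF→kF-equivariant = proj₂ kF-action

  on-κ : RingAction G_K κ
  on-κ = proj₁ κ-action

  OK̄→κ-equivariant : Equivariant G_K on-OK̄ on-κ OK̄→κ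
  OK̄→κ-equivariant = proj₂ κ-action

  private
    kF→κ : kF ⟶ κ
    kF→κ = k̄F→κ ∘ᵣ kF→k̄F

    kF→κ-equivariant : Equivariant G_K on-kF on-κ kF→κ
    kF→κ-equivariant γ y = begin
      ⟦ kF→κ ⟧ (⟦ act on-kF γ ⟧ y)                  ≈⟨ Hom.⟦⟧-cong (kF→κ ∘ᵣ act on-kF γ) πx≈y ⟨
      ⟦ kF→κ ⟧ (⟦ act on-kF γ ⟧ (⟦ OF→kF ⟧ x))      ≈⟨ Hom.⟦⟧-cong kF→κ (OF→kF-equivariant γ x) ⟨
      ⟦ kF→κ ⟧ (⟦ OF→kF ⟧ (⟦ act on-OF γ ⟧ x))      ≈⟨ OF→kF→κ _ ⟩
      ⟦ OK̄→κ ⟧ (⟦ OF→OK̄ ⟧ (⟦ act on-OF γ ⟧ x))      ≈⟨ Hom.⟦⟧-cong OK̄→κ (OF→OK̄-equivariant γ x) ⟩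
      ⟦ OK̄→κ ⟧ (⟦ act on-OK̄ γ ⟧ (⟦ OF→OK̄ ⟧ x))      ≈⟨ OK̄→κ-equivariant γ _ ⟩
      ⟦ act on-κ γ ⟧ (⟦ OK̄→κ ⟧ (⟦ OF→OK̄ ⟧ x))       ≈⟨ Hom.⟦⟧-cong (act on-κ γ) (OF→kF→κ x) ⟨
      ⟦ act on-κ γ ⟧ (⟦ kF→κ ⟧ (⟦ OF→kF ⟧ x))       ≈⟨ Hom.⟦⟧-cong (act on-κ γ ∘ᵣ kF→κ) πx≈y ⟩
      ⟦ act on-κ γ ⟧ (⟦ kF→κ ⟧ y)                   ∎
      where
      open SetoidReasoning (CommutativeRing.setoid κ)
      x : ∣ OF ∣
      x = proj₁ (proj₁ (proj₂ kF-residueField) y)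
      πx≈y : kF ∋ ⟦ OF→kF ⟧ x ≈ y
      πx≈y = proj₂ (proj₁ (proj₂ kF-residueField) y)

    k̄F-stable : ∀ γ x → ∃[ x′ ] (κ ∋ ⟦ k̄F→κ ⟧ x′ ≈ ⟦ act on-κ γ ⟧ (⟦ k̄F→κ ⟧ x))
    k̄F-stable γ x with proj₂ (proj₂ k̄F-separableClosure) x
    ... | p , (monic , _ , root) , separable =
      root-lifts twisted k̄F→κ (proj₁ κ-residueField) p
        (proj₂ k̄F-sepClosed (mapₚ twisted p) (PolyMap.map-monic twisted p monic) (PolyMap.map-separable twisted p separable)) _
        (root-map kF→k̄F (act on-κ γ ∘ᵣ k̄F→κ) (k̄F→κ ∘ᵣ twisted)
          (λ a → CommutativeRing.sym κ (kF→κ-equivariant γ a)) p x root)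
      where
      twisted : kF ⟶ k̄F
      twisted = kF→k̄F ∘ᵣ act on-kF γ

    k̄F→κ-injective : Injective k̄F→κ
    k̄F→κ-injective = field-injective k̄F→κ (proj₁ k̄F-sepClosed) (proj₁ κ-residueField)

    abstract
      k̄F-action : Σ[ ρ ∈ RingAction G_K k̄F ] Equivariant G_K ρ on-κ k̄F→κ
      k̄F-action = restrict-action G_K on-κ k̄F→κ k̄F→κ-injective k̄F-stable

  on-k̄F : RingAction G_K k̄F
  on-k̄F = proj₁ k̄F-action

  k̄F→κ-equivariant : Equivariant G_K on-k̄F on-κ k̄F→κ
  k̄F→κ-equivariant = proj₂ k̄F-action

  kF→k̄F-equivariant : Equivariant G_K on-kF on-k̄F kF→k̄F
  kF→k̄F-equivariant γ x = k̄F→κ-injective (trans (kF→κ-equivariant γ x) (sym (k̄F→κ-equivariant γ _)))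
    where open CommutativeRing κ using (trans; sym)

  private
    abstract
      OFˢʰ-action : Σ[ ρ ∈ RingAction G_K OFˢʰ ] (Equivariant G_K on-OF ρ OF→OFˢʰ × Equivariant G_K ρ on-k̄F OFˢʰ→k̄F)
      OFˢʰ-action = henselisation-action G_K OFˢʰ-strictHenselisation on-OF on-kF on-k̄F
                      OF→kF-equivariant kF→k̄F-equivariant

  on-OFˢʰ : RingAction G_K OFˢʰ
  on-OFˢʰ = proj₁ OFˢʰ-action

  OF→OFˢʰ-equivariant : Equivariant G_K on-OF on-OFˢʰ OF→OFˢʰ
  OF→OFˢʰ-equivariant = proj₁ (proj₂ OFˢʰ-action)

  OFˢʰ→k̄F-equivariant : Equivariant G_K on-OFˢʰ on-k̄F OFˢʰ→k̄F
  OFˢʰ→k̄F-equivariant = proj₂ (proj₂ OFˢʰ-action)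

  private
    abstract
      Fˢʰ-action : Σ[ ρ ∈ RingAction G_K Fˢʰ ] Equivariant G_K on-OFˢʰ ρ OFˢʰ→Fˢʰ
      Fˢʰ-action = fraction-action G_K on-OFˢʰ OFˢʰ→Fˢʰ Fˢʰ-fractionField

  on-Fˢʰ : RingAction G_K Fˢʰ
  on-Fˢʰ = proj₁ Fˢʰ-action

  OFˢʰ→Fˢʰ-equivariant : Equivariant G_K on-OFˢʰ on-Fˢʰ OFˢʰ→Fˢʰ
  OFˢʰ→Fˢʰ-equivariant = proj₂ Fˢʰ-action

  F→Fˢʰ-equivariant : Equivariant G_K on-F on-Fˢʰ F→Fˢʰ
  F→Fˢʰ-equivariant γ = fraction-unique OF→F OF→F-fractionField (proj₁ Fˢʰ-fractionField)
    (F→Fˢʰ ∘ᵣ act on-F γ) (act on-Fˢʰ γ ∘ᵣ F→Fˢʰ) (λ x → begin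
      ⟦ F→Fˢʰ ⟧ (⟦ act on-F γ ⟧ (⟦ OF→F ⟧ x))            ≈⟨ Hom.⟦⟧-cong F→Fˢʰ (OF→F-equivariant γ x) ⟨
      ⟦ F→Fˢʰ ⟧ (⟦ OF→F ⟧ (⟦ act on-OF γ ⟧ x))           ≈⟨ OF→F→Fˢʰ _ ⟩
      ⟦ OFˢʰ→Fˢʰ ⟧ (⟦ OF→OFˢʰ ⟧ (⟦ act on-OF γ ⟧ x))     ≈⟨ Hom.⟦⟧-cong OFˢʰ→Fˢʰ (OF→OFˢʰ-equivariant γ x) ⟩
      ⟦ OFˢʰ→Fˢʰ ⟧ (⟦ act on-OFˢʰ γ ⟧ (⟦ OF→OFˢʰ ⟧ x))   ≈⟨ OFˢʰ→Fˢʰ-equivariant γ _ ⟩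
      ⟦ act on-Fˢʰ γ ⟧ (⟦ OFˢʰ→Fˢʰ ⟧ (⟦ OF→OFˢʰ ⟧ x))    ≈⟨ Hom.⟦⟧-cong (act on-Fˢʰ γ) (OF→F→Fˢʰ x) ⟨
      ⟦ act on-Fˢʰ γ ⟧ (⟦ F→Fˢʰ ⟧ (⟦ OF→F ⟧ x))          ∎)
    where
    open SetoidReasoning (CommutativeRing.setoid Fˢʰ)
    OF→F-fractionField : IsFractionField OF→F
    OF→F-fractionField = closure-fractions O→K (proj₁ O-dvr) K→F (proj₁ (proj₂ F-galois)) OF→F OF-integralClosure
      (λ x → let p , (monic , _ , root) , _ = proj₂ (proj₂ (proj₂ F-galois)) x in p , monic , root)

-- Schemes are given by their functors of points, as in Demazure-Gabriel: a
-- scheme is a Zariski sheaf on (the opposite of) commutative rings covered by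
-- open subfunctors that are spectra of rings, and a morphism of schemes is a
-- natural transformation.
record ℤ-Functor (ℓ : Level) : Set (suc ℓ) where
  field
    points     : CRing ℓ → Setoid ℓ ℓ
    restrict   : ∀ {A B} → A ⟶ B → Func (points A) (points B)
  module At A = Setoid (points A)
  field
    restrict-≐  : ∀ {A B} {f g : A ⟶ B} → f ≐ g → ∀ x → At._≈_ B (restrict f ⟨$⟩ x) (restrict g ⟨$⟩ x)
    restrict-id : ∀ {A} x → At._≈_ A (restrict idᵣ ⟨$⟩ x) x
    restrict-∘  : ∀ {A B C} (g : B ⟶ C) (f : A ⟶ B) x →
                  At._≈_ C (restrict (g ∘ᵣ f) ⟨$⟩ x) (restrict g ⟨$⟩ (restrict f ⟨$⟩ x))

open ℤ-Functor public using (points; restrict)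

record _⇒_ {ℓ} (X Y : ℤ-Functor ℓ) : Set (suc ℓ) where
  field
    app     : ∀ A → Func (points X A) (points Y A)
    natural : ∀ {A B} (f : A ⟶ B) x →
              Setoid._≈_ (points Y B) (restrict Y f ⟨$⟩ (app A ⟨$⟩ x)) (app B ⟨$⟩ (restrict X f ⟨$⟩ x))

open _⇒_ public using (app)

_≋_ : ∀ {ℓ} {X Y : ℤ-Functor ℓ} → X ⇒ Y → X ⇒ Y → Set (suc ℓ)
_≋_ {Y = Y} f g = ∀ A x → Setoid._≈_ (points Y A) (app f A ⟨$⟩ x) (app g A ⟨$⟩ x)

idₛ : ∀ {ℓ} {X : ℤ-Functor ℓ} → X ⇒ X
idₛ {X = X} = record
  { app     = λ A → record { to = λ x → x ; cong = λ p → p }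
  ; natural = λ {A} {B} f x → Setoid.refl (points X B) }

_∘ₛ_ : ∀ {ℓ} {X Y Z : ℤ-Functor ℓ} → Y ⇒ Z → X ⇒ Y → X ⇒ Z
_∘ₛ_ {Z = Z} g f = record
  { app     = λ A → record { to = λ x → app g A ⟨$⟩ (app f A ⟨$⟩ x)
                           ; cong = λ p → Func.cong (app g A) (Func.cong (app f A) p) }
  ; natural = λ {A} {B} h x → Setoid.trans (points Z B) (_⇒_.natural g h _)
                                (Func.cong (app g B) (_⇒_.natural f h x)) }

Spec : ∀ {ℓ} → CRing ℓ → ℤ-Functor ℓ
Spec R = record
  { points = λ A → let open CommutativeRing A in record
    { Carrier = R ⟶ A
    ; _≈_     = _≐_
    ; isEquivalence = record
      { refl  = λ _ → refl
      ; sym   = λ p x → sym (p x)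
      ; trans = λ p q x → trans (p x) (q x) } }
  ; restrict    = λ f → record { to = λ x → f ∘ᵣ x ; cong = λ p r → _⟶_.⟦⟧-cong f (p r) }
  ; restrict-≐  = λ p x r → p _
  ; restrict-id = λ {A} x r → CommutativeRing.refl A
  ; restrict-∘  = λ {C = C} g f x r → CommutativeRing.refl C }

Spec₁ : ∀ {ℓ} {R R′ : CRing ℓ} → R ⟶ R′ → Spec R′ ⇒ Spec R
Spec₁ f = record
  { app     = λ A → record { to = λ x → x ∘ᵣ f ; cong = λ p r → p _ }
  ; natural = λ {A} {B} h x r → CommutativeRing.refl B }

IsLocalisationAt : ∀ {ℓ} {A B : CRing ℓ} → ∣ A ∣ → A ⟶ B → Set ℓ
IsLocalisationAt {A = A} {B} f φ =
  IsUnit B (⟦ φ ⟧ f) ×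
  (∀ b → ∃[ n ] ∃[ a ] (B ∋ b B.* ⟦ φ ⟧ (f ^ n) ≈ ⟦ φ ⟧ a)) ×
  (∀ a → B ∋ ⟦ φ ⟧ a ≈ B.0# → ∃[ n ] (A ∋ (f ^ n) A.* a ≈ A.0#))
  where
  module A = CommutativeRing A
  module B = CommutativeRing B
  open Exponentiation A.semiring using (_^_)

-- Spec A as a finite union of basic open sets D(fᵢ).
record ZariskiCover {ℓ} (A : CRing ℓ) : Set (suc ℓ) where
  open CommutativeRing A
  open Sum semiring using (sum)
  field
    size           : ℕ
    element        : Vector Carrier size
    unimodular     : Σ[ c ∈ Vector Carrier size ] (sum (λ i → c i * element i) ≈ 1#)
    patch          : Fin size → CRing ℓ
    localise       : ∀ i → A ⟶ patch i
    isLocalisation : ∀ i → IsLocalisationAt (element i) (localise i)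

-- Sections over D(fᵢ) and D(fⱼ) agree on D(fᵢ) ∩ D(fⱼ) when they agree on every
-- Spec C mapping to both.
IsZariskiSheaf : ∀ {ℓ} → ℤ-Functor ℓ → Set (suc ℓ)
IsZariskiSheaf {ℓ} X =
  ∀ {A : CRing ℓ} (U : ZariskiCover A) → let open ZariskiCover U in
  (s : ∀ i → Setoid.Carrier (points X (patch i))) →
  (∀ i j {C : CRing ℓ} (α : patch i ⟶ C) (β : patch j ⟶ C) → α ∘ᵣ localise i ≐ β ∘ᵣ localise j →
    Setoid._≈_ (points X C) (restrict X α ⟨$⟩ s i) (restrict X β ⟨$⟩ s j)) →
  ∃! (Setoid._≈_ (points X A))
     (λ x → ∀ i → Setoid._≈_ (points X (patch i)) (restrict X (localise i) ⟨$⟩ x) (s i))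

GeneratesUnitIdeal : ∀ {ℓ} {A B : CRing ℓ} → (∣ A ∣ → Set ℓ) → A ⟶ B → Set ℓ
GeneratesUnitIdeal {A = A} {B} I φ =
  ∃[ n ] Σ[ a ∈ Vector ∣ A ∣ n ] ((∀ i → I (a i)) × Σ[ c ∈ Vector ∣ B ∣ n ]
    (sum (λ i → c i * ⟦ φ ⟧ (a i)) ≈ 1#))
  where
  open CommutativeRing B
  open Sum semiring using (sum)

-- The pullback of u along any point x of X over A is the complement in Spec A
-- of the vanishing locus of a set I of functions.
IsOpenImmersion : ∀ {ℓ} {U X : ℤ-Functor ℓ} → U ⇒ X → Set (suc ℓ)
IsOpenImmersion {ℓ} {U} {X} u =
  (∀ A {y z} → Setoid._≈_ (points X A) (app u A ⟨$⟩ y) (app u A ⟨$⟩ z) → Setoid._≈_ (points U A) y z) ×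
  (∀ (A : CRing ℓ) x → Σ[ I ∈ (∣ A ∣ → Set ℓ) ] (∀ {B : CRing ℓ} (φ : A ⟶ B) →
    (∃[ y ] Setoid._≈_ (points X B) (app u B ⟨$⟩ y) (restrict X φ ⟨$⟩ x)) ⇔ GeneratesUnitIdeal I φ))

record IsScheme {ℓ} (X : ℤ-Functor ℓ) : Set (suc ℓ) where
  field
    isZariskiSheaf : IsZariskiSheaf X
    Index          : Set ℓ
    chartRing      : Index → CRing ℓ
    chart          : ∀ i → Spec (chartRing i) ⇒ X
    chart-open     : ∀ i → IsOpenImmersion (chart i)
    charts-cover   : ∀ (A : CRing ℓ) x → Σ[ U ∈ ZariskiCover A ] (let open ZariskiCover U in
                     ∀ k → ∃[ i ] ∃[ y ] Setoid._≈_ (points X (patch k))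
                       (app (chart i) (patch k) ⟨$⟩ y) (restrict X (localise k) ⟨$⟩ x))

record Scheme (ℓ : Level) : Set (suc ℓ) where
  field
    functor  : ℤ-Functor ℓ
    isScheme : IsScheme functor

open Scheme public using (functor)

-- Schemes are closed under fibre products of functors, so this is also the
-- fibre product of schemes.
FibreProduct : ∀ {ℓ} {X Y S : ℤ-Functor ℓ} → X ⇒ S → Y ⇒ S → ℤ-Functor ℓ
FibreProduct {X = X} {Y} {S} x y = record
  { points = λ A → record
    { Carrier = Σ[ p ∈ X.At.Carrier A ] Σ[ q ∈ Y.At.Carrier A ] S.At._≈_ A (app x A ⟨$⟩ p) (app y A ⟨$⟩ q)
    ; _≈_     = λ (p , q , _) (p′ , q′ , _) → X.At._≈_ A p p′ × Y.At._≈_ A q q′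
    ; isEquivalence = record
      { refl  = X.At.refl A , Y.At.refl A
      ; sym   = λ (e , e′) → X.At.sym A e , Y.At.sym A e′
      ; trans = λ (e , e′) (d , d′) → X.At.trans A e d , Y.At.trans A e′ d′ } }
  ; restrict = λ {A} {B} f → record
    { to   = λ (p , q , e) → restrict X f ⟨$⟩ p , restrict Y f ⟨$⟩ q ,
             S.At.trans B (S.At.sym B (_⇒_.natural x f p))
               (S.At.trans B (Func.cong (restrict S f) e) (_⇒_.natural y f q))
    ; cong = λ (e , e′) → Func.cong (restrict X f) e , Func.cong (restrict Y f) e′ }
  ; restrict-≐  = λ f≐g (p , q , _) → X.restrict-≐ f≐g p , Y.restrict-≐ f≐g q
  ; restrict-id = λ (p , q , _) → X.restrict-id p , Y.restrict-id q
  ; restrict-∘  = λ g f (p , q , _) → X.restrict-∘ g f p , Y.restrict-∘ g f q }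
  where
  module X = ℤ-Functor X
  module Y = ℤ-Functor Y
  module S = ℤ-Functor S

module _ {ℓ : Level} {X Y S : ℤ-Functor ℓ} {x : X ⇒ S} {y : Y ⇒ S} where

  projection₁ : FibreProduct x y ⇒ X
  projection₁ = record
    { app     = λ A → record { to = proj₁ ; cong = proj₁ }
    ; natural = λ {A} {B} f p → Setoid.refl (points X B) }

  projection₂ : FibreProduct x y ⇒ Y
  projection₂ = record
    { app     = λ A → record { to = λ p → proj₁ (proj₂ p) ; cong = proj₂ }
    ; natural = λ {A} {B} f p → Setoid.refl (points Y B) }

  pair : {T : ℤ-Functor ℓ} (f : T ⇒ X) (g : T ⇒ Y) → x ∘ₛ f ≋ y ∘ₛ g → T ⇒ FibreProduct x y
  pair f g e = record
    { app     = λ A → record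
      { to   = λ t → app f A ⟨$⟩ t , app g A ⟨$⟩ t , e A t
      ; cong = λ p → Func.cong (app f A) p , Func.cong (app g A) p }
    ; natural = λ h t → _⇒_.natural f h t , _⇒_.natural g h t }

EndSetoid : ∀ {a b} → Setoid a b → RawMonoid (a ⊔ b) (a ⊔ b)
EndSetoid P = record
  { Carrier = Func P P
  ; _≈_     = FuncEquality._≈_ P P
  ; _∙_     = λ g f → record { to = λ x → g ⟨$⟩ (f ⟨$⟩ x) ; cong = λ e → Func.cong g (Func.cong f e) }
  ; ε       = record { to = λ x → x ; cong = λ e → e } }

End : ∀ {ℓ} → ℤ-Functor ℓ → RawMonoid (suc ℓ) (suc ℓ)
End X = record { Carrier = X ⇒ X ; _≈_ = _≋_ ; _∙_ = _∘ₛ_ ; ε = idₛ }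

-- As G is a group, this is an action by automorphisms.
Action : ∀ {g g′ ℓ} → Group g g′ → ℤ-Functor ℓ → Set (g ⊔ g′ ⊔ suc ℓ)
Action G X = MonoidHomomorphism (Group.rawMonoid G) (End X)

Semilinear : ∀ {ℓ} {X Y S : ℤ-Functor ℓ} → X ⇒ S → Y ⇒ S → S ⇒ S → X ⇒ Y → Set (suc ℓ)
Semilinear x y α f = y ∘ₛ f ≋ α ∘ₛ x

module _ {g g′ ℓ : Level} {G : Group g g′} {X S : ℤ-Functor ℓ} (ρˢ : Action G S) (x : X ⇒ S) where

  IsSemilinearAction : (Group.Carrier G → X ⇒ X) → Set (g ⊔ g′ ⊔ suc ℓ)
  IsSemilinearAction act =
    IsMonoidHomomorphism (Group.rawMonoid G) (End X) act ×
    (∀ σ → Semilinear x x (MonoidHomomorphism.⟦_⟧ ρˢ σ) (act σ))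

  SemilinearAction : Set (g ⊔ g′ ⊔ suc ℓ)
  SemilinearAction = Σ (Group.Carrier G → X ⇒ X) IsSemilinearAction

module _ {ℓ : Level} {X S S′ : ℤ-Functor ℓ} {x : X ⇒ S} {s : S′ ⇒ S} {α : S ⇒ S} {β : S′ ⇒ S′} {f : X ⇒ X} where

  baseChange : Semilinear s s α β → Semilinear x x α f → FibreProduct x s ⇒ FibreProduct x s
  baseChange s-semilinear f-semilinear = pair {x = x} {y = s}
    (f ∘ₛ projection₁ {x = x} {y = s}) (β ∘ₛ projection₂ {x = x} {y = s})
    (λ A (p , q , e) → S.At.trans A (f-semilinear A p)
      (S.At.trans A (Func.cong (app α A) e) (S.At.sym A (s-semilinear A q))))
    where module S = ℤ-Functor S

-- X(T) = Hom_S(T, X).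
Points : ∀ {ℓ} {T X S : ℤ-Functor ℓ} → T ⇒ S → X ⇒ S → Setoid (suc ℓ) (suc ℓ)
Points {T = T} {X} t x = record
  { Carrier = Σ[ P ∈ (T ⇒ X) ] (x ∘ₛ P ≋ t)
  ; _≈_     = λ (P , _) (Q , _) → P ≋ Q
  ; isEquivalence = record
    { refl  = λ A _ → Setoid.refl (points X A)
    ; sym   = λ p A y → Setoid.sym (points X A) (p A y)
    ; trans = λ p q A y → Setoid.trans (points X A) (p A y) (q A y) } }

module _ {g g′ ℓ : Level} {G : Group g g′} {S T X : ℤ-Functor ℓ}
         (ρˢ : Action G S) (ρᵀ : Action G T) (t : T ⇒ S) (x : X ⇒ S)
         (t-semilinear : ∀ σ → Semilinear t t (MonoidHomomorphism.⟦_⟧ ρˢ σ) (MonoidHomomorphism.⟦_⟧ ρᵀ σ)) where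
  private
    module G = Group G
    module S = ℤ-Functor S
    module T = ℤ-Functor T
    module ρˢ = MonoidHomomorphism ρˢ
    module ρᵀ = MonoidHomomorphism ρᵀ

  -- P ↦ σ_X ∘ P ∘ σ_T⁻¹.
  movePoint : ∀ σ {f : X ⇒ X} → Semilinear x x ρˢ.⟦ σ ⟧ f → Func (Points t x) (Points t x)
  movePoint σ {f} f-semilinear = record
    { to   = λ (P , P-over) → f ∘ₛ P ∘ₛ ρᵀ.⟦ σ G.⁻¹ ⟧ , λ A y → S.At.trans A (f-semilinear A _)
               (S.At.trans A (Func.cong (app ρˢ.⟦ σ ⟧ A) (P-over A _))
               (S.At.trans A (S.At.sym A (t-semilinear σ A _))
               (Func.cong (app t A) (T.At.trans A (T.At.sym A (ρᵀ.homo σ (σ G.⁻¹) A y))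
                 (T.At.trans A (ρᵀ.⟦⟧-cong (G.inverseʳ σ) A y) (ρᵀ.ε-homo A y))))))
    ; cong = λ P≋Q A y → Func.cong (app f A) (P≋Q A _) }

Image : ∀ {a b c d} {P : Setoid a b} {Q : Setoid c d} → Func P Q → Setoid (a ⊔ c ⊔ d) d
Image {P = P} {Q} f = record
  { Carrier = Σ[ y ∈ Setoid.Carrier Q ] ∃[ x ] (Setoid._≈_ Q (f ⟨$⟩ x) y)
  ; _≈_     = λ y z → Setoid._≈_ Q (proj₁ y) (proj₁ z)
  ; isEquivalence = record { refl = Setoid.refl Q ; sym = Setoid.sym Q ; trans = Setoid.trans Q } }

module SpecActions {ℓ g g′ : Level} (D : Setting ℓ) (G : Group g g′)
    (θ : GroupHomomorphism (Group.rawGroup G) (Group.rawGroup (GaloisActions.G_K D))) where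
  open GaloisActions D
  private
    module G = Group G
    module Γ = Group G_K
    module θ = GroupHomomorphism θ
    module Act {A : CRing ℓ} (ρ : RingAction G_K A) = MonoidHomomorphism ρ

    open GroupProperties G_K using (⁻¹-anti-homo-∙; ε⁻¹≈ε)

    inv : G.Carrier → Γ.Carrier
    inv σ = θ.⟦ σ ⟧ Γ.⁻¹

    inv-∙ : ∀ σ τ → inv (σ G.∙ τ) Γ.≈ inv τ Γ.∙ inv σ
    inv-∙ σ τ = Γ.trans {inv (σ G.∙ τ)} {(θ.⟦ σ ⟧ Γ.∙ θ.⟦ τ ⟧) Γ.⁻¹} {inv τ Γ.∙ inv σ}
      (Γ.⁻¹-cong {θ.⟦ σ G.∙ τ ⟧} {θ.⟦ σ ⟧ Γ.∙ θ.⟦ τ ⟧} (θ.homo σ τ)) (⁻¹-anti-homo-∙ θ.⟦ σ ⟧ θ.⟦ τ ⟧)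

    inv-ε : inv G.ε Γ.≈ Γ.ε
    inv-ε = Γ.trans {inv G.ε} {Γ.ε Γ.⁻¹} {Γ.ε} (Γ.⁻¹-cong {θ.⟦ G.ε ⟧} {Γ.ε} θ.ε-homo) ε⁻¹≈ε

  -- σ ↦ (θ(σ)⁻¹)^*.
  specAction : {A : CRing ℓ} → RingAction G_K A → Action G (Spec A)
  specAction {A} ρ = record
    { ⟦_⟧ = λ σ → Spec₁ (act ρ (inv σ))
    ; isMonoidHomomorphism = record
      { isMagmaHomomorphism = record
        { isRelHomomorphism = record
          { cong = λ {σ} {τ} σ≈τ B h r → Hom.⟦⟧-cong h (Act.⟦⟧-cong ρ {inv σ} {inv τ}
              (Γ.⁻¹-cong {θ.⟦ σ ⟧} {θ.⟦ τ ⟧} (θ.⟦⟧-cong σ≈τ)) r) }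
        ; homo = λ σ τ B h r → Hom.⟦⟧-cong h (A.trans
            (Act.⟦⟧-cong ρ {inv (σ G.∙ τ)} {inv τ Γ.∙ inv σ} (inv-∙ σ τ) r) (Act.homo ρ (inv τ) (inv σ) r)) }
      ; ε-homo = λ B h r → Hom.⟦⟧-cong h (A.trans
          (Act.⟦⟧-cong ρ {inv G.ε} {Γ.ε} inv-ε r) (Act.ε-homo ρ r)) } }
    where
    module A = CommutativeRing A

  Spec₁-semilinear : {A B : CRing ℓ} (ρᴬ : RingAction G_K A) (ρᴮ : RingAction G_K B) (f : A ⟶ B) →
    Equivariant G_K ρᴬ ρᴮ f → ∀ σ →
    Semilinear (Spec₁ f) (Spec₁ f) (MonoidHomomorphism.⟦_⟧ (specAction ρᴬ) σ) (MonoidHomomorphism.⟦_⟧ (specAction ρᴮ) σ)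
  Spec₁-semilinear {B = B} ρᴬ ρᴮ f f-equivariant σ C h r =
    Hom.⟦⟧-cong h (CommutativeRing.sym B (f-equivariant (inv σ) r))

record Model {ℓ} (D : Setting ℓ) {X : ℤ-Functor ℓ} (X→F : X ⇒ Spec (Setting.F D)) : Set (suc ℓ) where
  open Setting D
  field
    𝒳    : Scheme ℓ
    𝒳→OF : functor 𝒳 ⇒ Spec OF

  genericFibre : ℤ-Functor ℓ
  genericFibre = FibreProduct 𝒳→OF (Spec₁ OF→F)

  specialFibre : ℤ-Functor ℓ
  specialFibre = FibreProduct 𝒳→OF (Spec₁ OF→kF)

  specialFibre→kF : specialFibre ⇒ Spec kF
  specialFibre→kF = projection₂ {x = 𝒳→OF} {y = Spec₁ OF→kF}

  field
    i       : genericFibre ⇒ X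
    i⁻¹     : X ⇒ genericFibre
    i-i⁻¹   : i ∘ₛ i⁻¹ ≋ idₛ
    i⁻¹-i   : i⁻¹ ∘ₛ i ≋ idₛ
    i-over-F : X→F ∘ₛ i ≋ projection₂ {x = 𝒳→OF} {y = Spec₁ OF→F}

  𝒳⟨OFˢʰ⟩ : Setoid (suc ℓ) (suc ℓ)
  𝒳⟨OFˢʰ⟩ = Points (Spec₁ OF→OFˢʰ) 𝒳→OF

  X⟨Fˢʰ⟩ : Setoid (suc ℓ) (suc ℓ)
  X⟨Fˢʰ⟩ = Points (Spec₁ F→Fˢʰ) X→F

  𝒳ₖ⟨k̄F⟩ : Setoid (suc ℓ) (suc ℓ)
  𝒳ₖ⟨k̄F⟩ = Points (Spec₁ kF→k̄F) specialFibre→kF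

  private
    over : ∀ {A B R : CRing ℓ} (p : OF ⟶ A) (q : A ⟶ R) (r : OF ⟶ B) (s : B ⟶ R) (P : Spec B ⇒ functor 𝒳) →
      q ∘ᵣ p ≐ s ∘ᵣ r → 𝒳→OF ∘ₛ P ≋ Spec₁ r → 𝒳→OF ∘ₛ P ∘ₛ Spec₁ s ≋ Spec₁ p ∘ₛ Spec₁ q
    over p q r s P square P-over C h a = C.trans (P-over C _ a) (C.sym (Hom.⟦⟧-cong h (square a)))
      where module C = CommutativeRing C

  toGeneric : Func 𝒳⟨OFˢʰ⟩ X⟨Fˢʰ⟩
  toGeneric = record
    { to   = λ (P , P-over) →
        let P′ = pair {x = 𝒳→OF} {y = Spec₁ OF→F} (P ∘ₛ Spec₁ OFˢʰ→Fˢʰ) (Spec₁ F→Fˢʰ) (over OF→F F→Fˢʰ OF→OFˢʰ OFˢʰ→Fˢʰ P OF→F→Fˢʰ P-over)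
        in i ∘ₛ P′ , λ A y → i-over-F A (app P′ A ⟨$⟩ y)
    ; cong = λ P≋Q A y → Func.cong (app i A) (P≋Q A _ , λ _ → CommutativeRing.refl A) }

  reduce : Func 𝒳⟨OFˢʰ⟩ 𝒳ₖ⟨k̄F⟩
  reduce = record
    { to   = λ (P , P-over) →
        pair {x = 𝒳→OF} {y = Spec₁ OF→kF} (P ∘ₛ Spec₁ OFˢʰ→k̄F) (Spec₁ kF→k̄F) (over OF→kF kF→k̄F OF→OFˢʰ OFˢʰ→k̄F P square P-over) ,
        λ A y r → CommutativeRing.refl A
    ; cong = λ P≋Q A y → P≋Q A _ , λ _ → CommutativeRing.refl A }
    where
    square : kF→k̄F ∘ᵣ OF→kF ≐ OFˢʰ→k̄F ∘ᵣ OF→OFˢʰ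
    square a = CommutativeRing.sym k̄F (IsStrictHenselisation.commutes OFˢʰ-strictHenselisation a)

  I : Setoid (suc ℓ) (suc ℓ)
  I = Image reduce

  include : Func I 𝒳ₖ⟨k̄F⟩
  include = record { to = proj₁ ; cong = λ e → e }

  reduceToI : Func 𝒳⟨OFˢʰ⟩ I
  reduceToI = record
    { to   = λ P → reduce ⟨$⟩ P , P , Setoid.refl 𝒳ₖ⟨k̄F⟩ {reduce ⟨$⟩ P}
    ; cong = λ {P} {Q} → Func.cong reduce {P} {Q} }

module SemilinearModel {ℓ g g′ : Level} (D : Setting ℓ) (G : Group g g′)
    (θ : GroupHomomorphism (Group.rawGroup G) (Group.rawGroup (GaloisActions.G_K D)))
    {X : ℤ-Functor ℓ} {X→F : X ⇒ Spec (Setting.F D)}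
    (ρ : SemilinearAction {G = G} (SpecActions.specAction D G θ (GaloisActions.on-F D)) X→F)
    (M : Model D X→F) where
  open Setting D
  open GaloisActions D
  open SpecActions D G θ
  open Model M
  private
    module G = Group G

  on : {A : CRing ℓ} → RingAction G_K A → G.Carrier → Spec A ⇒ Spec A
  on ρ σ = MonoidHomomorphism.⟦_⟧ (specAction ρ) σ

  IsExtension : G.Carrier → functor 𝒳 ⇒ functor 𝒳 → Set (suc ℓ)
  IsExtension σ f =
    Σ[ f-semilinear ∈ Semilinear 𝒳→OF 𝒳→OF (on on-OF σ) f ]
      (i ∘ₛ baseChange {x = 𝒳→OF} {s = Spec₁ OF→F} {α = on on-OF σ} {β = on on-F σ} {f = f}
              (Spec₁-semilinear on-OF on-F OF→F OF→F-equivariant σ) f-semilinear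
        ≋ proj₁ ρ σ ∘ₛ i)

  ExtendsUniquely : Set (g ⊔ suc ℓ)
  ExtendsUniquely = ∀ σ → ∃! _≋_ (IsExtension σ)

  move-X : G.Carrier → Func X⟨Fˢʰ⟩ X⟨Fˢʰ⟩
  move-X σ = movePoint {G = G} (specAction on-F) (specAction on-Fˢʰ) (Spec₁ F→Fˢʰ) X→F
    (Spec₁-semilinear on-F on-Fˢʰ F→Fˢʰ F→Fˢʰ-equivariant) σ {proj₁ ρ σ} (proj₂ (proj₂ ρ) σ)

  module Extended (extend : ExtendsUniquely) where

    σ-𝒳 : G.Carrier → functor 𝒳 ⇒ functor 𝒳
    σ-𝒳 σ = proj₁ (extend σ)

    private
      semilinear : ∀ σ → Semilinear 𝒳→OF 𝒳→OF (on on-OF σ) (σ-𝒳 σ)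
      semilinear σ = proj₁ (proj₁ (proj₂ (extend σ)))

    σ-𝒳ₖ : G.Carrier → specialFibre ⇒ specialFibre
    σ-𝒳ₖ σ = baseChange {x = 𝒳→OF} {s = Spec₁ OF→kF} {α = on on-OF σ} {β = on on-kF σ} {f = σ-𝒳 σ}
      (Spec₁-semilinear on-OF on-kF OF→kF OF→kF-equivariant σ) (semilinear σ)

    move-𝒳 : G.Carrier → Func 𝒳⟨OFˢʰ⟩ 𝒳⟨OFˢʰ⟩
    move-𝒳 σ = movePoint {G = G} (specAction on-OF) (specAction on-OFˢʰ) (Spec₁ OF→OFˢʰ) 𝒳→OF
      (Spec₁-semilinear on-OF on-OFˢʰ OF→OFˢʰ OF→OFˢʰ-equivariant) σ {σ-𝒳 σ} (semilinear σ)

    move-𝒳ₖ : G.Carrier → Func 𝒳ₖ⟨k̄F⟩ 𝒳ₖ⟨k̄F⟩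
    move-𝒳ₖ σ = movePoint {G = G} (specAction on-kF) (specAction on-k̄F) (Spec₁ kF→k̄F) specialFibre→kF
      (Spec₁-semilinear on-kF on-k̄F kF→k̄F kF→k̄F-equivariant) σ {σ-𝒳ₖ σ} (λ A p r → CommutativeRing.refl A)

{-# OPTIONS --safe #-}
module Submission where

-- The identity extends ε_X, and if f extends σ_X and h extends τ_X then f ∘ h
-- extends (στ)_X; uniqueness of the extensions makes σ ↦ σ_𝒳 an action.
-- The reduction and the generic point of P are P ∘ Spec u for an equivariant
-- homomorphism u out of OFˢʰ, paired with the structure map t, and t equals
-- its conjugate σ_S ∘ t ∘ σ_T⁻¹ because it is equivariant.  Equivariance and
-- injectivity of 𝒳(OFˢʰ) → X(Fˢʰ) show that the lift of σ Q, computed on the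
-- generic fibre, is σ Q itself; reducing it gives the action on I.

open import Defs
open import Level using (Level)
open import Algebra.Bundles using (CommutativeRing; Group)
open import Algebra.Bundles.Raw using (RawMonoid)
open import Algebra.Morphism.Bundles using (GroupHomomorphism; MonoidHomomorphism)
open import Algebra.Morphism.Structures using (IsMonoidHomomorphism)
import Algebra.Properties.Group as GroupProperties
open import Data.Product using (Σ-syntax; _×_; _,_; proj₁; proj₂)
open import Function.Bundles using (Func; _⟨$⟩_)
open import Function.Definitions using (Bijective)
open import Relation.Binary.Bundles using (Setoid)
import Relation.Binary.Reasoning.Setoid as SetoidReasoning

isMonoidHomomorphism : ∀ {g g′ m m′} {G : Group g g′} (M : RawMonoid m m′) → let module G = Group G; module M = RawMonoid M in
  (f : G.Carrier → M.Carrier) →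
  (∀ {σ τ} → σ G.≈ τ → f σ M.≈ f τ) → (∀ σ τ → f (σ G.∙ τ) M.≈ f σ M.∙ f τ) → f G.ε M.≈ M.ε →
  IsMonoidHomomorphism G.rawMonoid M f
isMonoidHomomorphism M f f-cong f-∙ f-ε = record
  { isMagmaHomomorphism = record { isRelHomomorphism = record { cong = f-cong } ; homo = f-∙ }
  ; ε-homo = f-ε }

module _ {g g′ ℓ : Level} {G : Group g g′} {S S′ X : ℤ-Functor ℓ}
         (ρ : Action G S) (ρ′ : Action G S′) {s : S′ ⇒ S} {x : X ⇒ S}
         (s-semilinear : ∀ σ → Semilinear s s (MonoidHomomorphism.⟦_⟧ ρ σ) (MonoidHomomorphism.⟦_⟧ ρ′ σ)) where
  private
    module ρ = MonoidHomomorphism ρ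
    module ρ′ = MonoidHomomorphism ρ′

  -- A point of the fibre product is a pair on which `baseChange` acts componentwise, so each action
  -- law splits into the law for `act` and the law for `ρ′`. Semilinearity over `S′` is
  -- definitional, since the second component of the base change is `ρ′` itself.
  baseChange-action : ∀ {act} → IsMonoidHomomorphism (Group.rawMonoid G) (End X) act →
    (semilinear : ∀ σ → Semilinear x x ρ.⟦ σ ⟧ (act σ)) →
    IsSemilinearAction {G = G} ρ′ (projection₂ {x = x} {y = s})
      (λ σ → baseChange {x = x} {s = s} {α = ρ.⟦ σ ⟧} {β = ρ′.⟦ σ ⟧} {f = act σ} (s-semilinear σ) (semilinear σ))
  baseChange-action {act} isAction semilinear =
    isMonoidHomomorphism {G = G} (End (FibreProduct x s)) _
      (λ σ≈τ A (p , q , _) → act.⟦⟧-cong σ≈τ A p , ρ′.⟦⟧-cong σ≈τ A q)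
      (λ σ τ A (p , q , _) → act.homo σ τ A p , ρ′.homo σ τ A q)
      (λ A (p , q , _) → act.ε-homo A p , ρ′.ε-homo A q)
    , λ σ A _ → Setoid.refl (points S′ A)
    where module act = IsMonoidHomomorphism isAction

module _ {g g′ ℓ : Level} {G : Group g g′} {S T X : ℤ-Functor ℓ}
         (ρˢ : Action G S) (ρᵀ : Action G T) (t : T ⇒ S) (x : X ⇒ S)
         (t-semilinear : ∀ σ → Semilinear t t (MonoidHomomorphism.⟦_⟧ ρˢ σ) (MonoidHomomorphism.⟦_⟧ ρᵀ σ)) where
  private
    module G = Group G
    module X = ℤ-Functor X
    module T = ℤ-Functor T
    module ρˢ = MonoidHomomorphism ρˢ
    module ρᵀ = MonoidHomomorphism ρᵀ
    open GroupProperties G using (⁻¹-anti-homo-∙; ε⁻¹≈ε)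

  -- Inversion reverses products and precomposition reverses them once more, so conjugation is a
  -- left action. Points are equal when their underlying morphisms are, so only these are compared.
  movePoint-action : ∀ {act} → IsMonoidHomomorphism G.rawMonoid (End X) act →
    (semilinear : ∀ σ → Semilinear x x ρˢ.⟦ σ ⟧ (act σ)) →
    IsMonoidHomomorphism G.rawMonoid (EndSetoid (Points t x))
      (λ σ → movePoint {G = G} ρˢ ρᵀ t x t-semilinear σ {act σ} (semilinear σ))
  movePoint-action {act} isAction semilinear =
    isMonoidHomomorphism {G = G} (EndSetoid (Points t x)) _
      (λ {σ} {τ} σ≈τ (P , _) A y → X.At.trans A (act.⟦⟧-cong σ≈τ A _)
        (Func.cong (app (act τ) A) (Func.cong (app P A) (ρᵀ.⟦⟧-cong (G.⁻¹-cong σ≈τ) A y))))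
      (λ σ τ (P , _) A y → X.At.trans A (act.homo σ τ A _)
        (Func.cong (app (act σ) A) (Func.cong (app (act τ) A) (Func.cong (app P A)
          (T.At.trans A (ρᵀ.⟦⟧-cong (⁻¹-anti-homo-∙ σ τ) A y) (ρᵀ.homo (τ G.⁻¹) (σ G.⁻¹) A y))))))
      (λ (P , _) A y → X.At.trans A (act.ε-homo A _)
        (Func.cong (app P A) (T.At.trans A (ρᵀ.⟦⟧-cong ε⁻¹≈ε A y) (ρᵀ.ε-homo A y))))
    where module act = IsMonoidHomomorphism isAction

module _ {g g′ ℓ : Level} {G : Group g g′} {S T : ℤ-Functor ℓ} (ρˢ : Action G S) (ρᵀ : Action G T) (t : T ⇒ S)
         (t-semilinear : ∀ σ → Semilinear t t (MonoidHomomorphism.⟦_⟧ ρˢ σ) (MonoidHomomorphism.⟦_⟧ ρᵀ σ)) where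
  private
    module G = Group G
    module S = ℤ-Functor S
    module T = ℤ-Functor T
    module ρˢ = MonoidHomomorphism ρˢ
    module ρᵀ = MonoidHomomorphism ρᵀ

  -- Insert `σ σ⁻¹ = ε`, acting on `T`, in front of `t`, then carry `σ` across `t` by semilinearity.
  -- This handles the structure-map component of a point of a fibre.
  conjugate-semilinear : ∀ σ → t ≋ ρˢ.⟦ σ ⟧ ∘ₛ t ∘ₛ ρᵀ.⟦ σ G.⁻¹ ⟧
  conjugate-semilinear σ A y = S.At.trans A
    (Func.cong (app t A) (T.At.sym A (T.At.trans A (T.At.sym A (ρᵀ.homo σ (σ G.⁻¹) A y))
      (T.At.trans A (ρᵀ.⟦⟧-cong (G.inverseʳ σ) A y) (ρᵀ.ε-homo A y)))))
    (t-semilinear σ A _)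

module _ {g g′ a b c d : Level} {G : Group g g′} {P : Setoid a b} {Q : Setoid c d} (r : Func P Q)
         {moveᴾ : Group.Carrier G → Func P P} {moveᵠ : Group.Carrier G → Func Q Q}
         (action : IsMonoidHomomorphism (Group.rawMonoid G) (EndSetoid Q) moveᵠ)
         (equivariant : ∀ σ x → Setoid._≈_ Q (r ⟨$⟩ (moveᴾ σ ⟨$⟩ x)) (moveᵠ σ ⟨$⟩ (r ⟨$⟩ x))) where
  private
    module Q = Setoid Q
    module action = IsMonoidHomomorphism action

  -- A point of the image carries a preimage, which `moveᴾ` carries along; equivariance certifies
  -- the result as a preimage of the moved point. Equality in the image is equality in `Q`, so the
  -- action laws are inherited from there.
  image-action : MonoidHomomorphism (Group.rawMonoid G) (EndSetoid (Image r))
  image-action = record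
    { ⟦_⟧ = λ σ → record
      { to   = λ (y , x , rx≈y) → moveᵠ σ ⟨$⟩ y , moveᴾ σ ⟨$⟩ x , Q.trans (equivariant σ x) (Func.cong (moveᵠ σ) rx≈y)
      ; cong = Func.cong (moveᵠ σ) }
    ; isMonoidHomomorphism = isMonoidHomomorphism {G = G} (EndSetoid (Image r)) _
        (λ σ≈τ y → action.⟦⟧-cong σ≈τ (proj₁ y))
        (λ σ τ y → action.homo σ τ (proj₁ y))
        (λ y → action.ε-homo (proj₁ y)) }

module _ {ℓ g g′ : Level} (D : Setting ℓ) (G : Group g g′)
    (θ : GroupHomomorphism (Group.rawGroup G) (Group.rawGroup (GaloisActions.G_K D)))
    {X : ℤ-Functor ℓ} {X→F : X ⇒ Spec (Setting.F D)}
    (ρ : SemilinearAction {G = G} (SpecActions.specAction D G θ (GaloisActions.on-F D)) X→F)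
    (M : Model D X→F) where
  open Setting D
  open GaloisActions D
  open SpecActions D G θ
  open Model M
  open SemilinearModel D G θ ρ M
  private
    module G = Group G
    module ρ = IsMonoidHomomorphism (proj₁ (proj₂ ρ))
    module X = ℤ-Functor X
    module OF = ℤ-Functor (Spec OF)
    module 𝒳 = ℤ-Functor (functor 𝒳)
    module on-OF = MonoidHomomorphism (specAction on-OF)
    module on-F = MonoidHomomorphism (specAction on-F)

  IsExtension-ε : IsExtension G.ε idₛ
  IsExtension-ε =
    (λ A p → OF.At.sym A {app (on on-OF G.ε) A ⟨$⟩ (app 𝒳→OF A ⟨$⟩ p)} {app 𝒳→OF A ⟨$⟩ p}
      (on-OF.ε-homo A (app 𝒳→OF A ⟨$⟩ p))) ,
    λ A (p , q , e) → X.At.trans A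
      (Func.cong (app i A) (𝒳.At.refl A , on-F.ε-homo A q))
      (X.At.sym A (ρ.ε-homo A _))

  -- Uniqueness is available for one group element at a time, so comparing `σ-𝒳 σ` with `σ-𝒳 τ` for
  -- `σ ≈ τ` first requires both to extend the same element.
  IsExtension-cong : ∀ {σ τ} → σ G.≈ τ → ∀ {f} → IsExtension σ f → IsExtension τ f
  IsExtension-cong {σ} {τ} σ≈τ {f} (f-semilinear , f-extends) =
    f-semilinear′ ,
    λ A (p , q , e) → X.At.trans A
      (Func.cong (app i A) (𝒳.At.refl A , on-F.⟦⟧-cong (G.sym σ≈τ) A q))
      (X.At.trans A (f-extends A (p , q , e)) (ρ.⟦⟧-cong σ≈τ A _))
    where
    f-semilinear′ : Semilinear 𝒳→OF 𝒳→OF (on on-OF τ) f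
    f-semilinear′ A p r = CommutativeRing.trans A (f-semilinear A p r) (on-OF.⟦⟧-cong σ≈τ A (app 𝒳→OF A ⟨$⟩ p) r)

  IsExtension-∙ : ∀ {σ τ f h} → IsExtension σ f → IsExtension τ h → IsExtension (σ G.∙ τ) (f ∘ₛ h)
  IsExtension-∙ {σ} {τ} {f} {h} (f-semilinear , f-extends) (h-semilinear , h-extends) =
    fh-semilinear ,
    λ A (p , q , e) → X.At.trans A
      (Func.cong (app i A) (𝒳.At.refl A , on-F.homo σ τ A q))
      -- Pasting of the two extension squares: the one for `f` is taken at the image of the point
      -- under the base change of `h`, and the one for `h` follows under `σ_X`.
      (X.At.trans A (f-extends A (app (bc h-semilinear) A ⟨$⟩ (p , q , e)))
      (X.At.trans A (Func.cong (app (proj₁ ρ σ) A) (h-extends A (p , q , e)))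
        (X.At.sym A (ρ.homo σ τ A _))))
    where
    bc : Semilinear 𝒳→OF 𝒳→OF (on on-OF τ) h → genericFibre ⇒ genericFibre
    bc = baseChange {x = 𝒳→OF} {s = Spec₁ OF→F} {α = on on-OF τ} {β = on on-F τ} {f = h}
           (Spec₁-semilinear on-OF on-F OF→F OF→F-equivariant τ)
    fh-semilinear : Semilinear 𝒳→OF 𝒳→OF (on on-OF (σ G.∙ τ)) (f ∘ₛ h)
    fh-semilinear A p r = A.trans (f-semilinear A (app h A ⟨$⟩ p) r)
      (A.trans (Func.cong (app (on on-OF σ) A) {app (𝒳→OF ∘ₛ h) A ⟨$⟩ p} {app (on on-OF τ ∘ₛ 𝒳→OF) A ⟨$⟩ p} (h-semilinear A p) r)
        (A.sym (on-OF.homo σ τ A (app 𝒳→OF A ⟨$⟩ p) r)))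
      where module A = CommutativeRing A

  module _ (extend : ExtendsUniquely) where
    open Extended extend
    private
      isExtension : ∀ σ → IsExtension σ (σ-𝒳 σ)
      isExtension σ = proj₁ (proj₂ (extend σ))

      unique : ∀ σ {f} → IsExtension σ f → σ-𝒳 σ ≋ f
      unique σ {f} = proj₂ (proj₂ (extend σ)) {f}

    σ-𝒳-semilinear : ∀ σ → Semilinear 𝒳→OF 𝒳→OF (on on-OF σ) (σ-𝒳 σ)
    σ-𝒳-semilinear σ = proj₁ (isExtension σ)

    σ-𝒳-action : IsMonoidHomomorphism G.rawMonoid (End (functor 𝒳)) σ-𝒳
    σ-𝒳-action = isMonoidHomomorphism {G = G} (End (functor 𝒳)) σ-𝒳
      (λ {σ} {τ} σ≈τ → unique σ {σ-𝒳 τ} (IsExtension-cong (G.sym σ≈τ) {σ-𝒳 τ} (isExtension τ)))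
      (λ σ τ → unique (σ G.∙ τ) {σ-𝒳 σ ∘ₛ σ-𝒳 τ} (IsExtension-∙ {f = σ-𝒳 σ} {h = σ-𝒳 τ} (isExtension σ) (isExtension τ)))
      (unique G.ε {idₛ} IsExtension-ε)

    private
      -- Both sides begin with `σ-𝒳 σ` after `P`, so the claim reduces to commuting `Spec₁ u` with
      -- the action of `σ⁻¹`. It is applied with `u` the map to `Fˢʰ` and the map to `k̄F`.
      restrict-𝒳-equivariant : ∀ {R} (ρᴿ : RingAction G_K R) (u : OFˢʰ ⟶ R) → Equivariant G_K on-OFˢʰ ρᴿ u →
        ∀ σ (P : Spec OFˢʰ ⇒ functor 𝒳) →
        (σ-𝒳 σ ∘ₛ P ∘ₛ on on-OFˢʰ (σ G.⁻¹)) ∘ₛ Spec₁ u ≋ σ-𝒳 σ ∘ₛ (P ∘ₛ Spec₁ u) ∘ₛ on ρᴿ (σ G.⁻¹)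
      restrict-𝒳-equivariant {R} ρᴿ u u-equivariant σ P A y = Func.cong (app (σ-𝒳 σ) A) (Func.cong (app P A)
        (ℤ-Functor.At.sym (Spec OFˢʰ) A {app (Spec₁ u ∘ₛ on ρᴿ (σ G.⁻¹)) A ⟨$⟩ y} {app (on on-OFˢʰ (σ G.⁻¹) ∘ₛ Spec₁ u) A ⟨$⟩ y}
          (Spec₁-semilinear on-OFˢʰ ρᴿ u u-equivariant (σ G.⁻¹) A y)))

    toGeneric-equivariant : ∀ σ P →
      Setoid._≈_ X⟨Fˢʰ⟩ (toGeneric ⟨$⟩ (move-𝒳 σ ⟨$⟩ P)) (move-X σ ⟨$⟩ (toGeneric ⟨$⟩ P))
    toGeneric-equivariant σ (P , _) A y = X.At.trans A
      (Func.cong (app i A)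
        ( restrict-𝒳-equivariant on-Fˢʰ OFˢʰ→Fˢʰ OFˢʰ→Fˢʰ-equivariant σ P A y
        , conjugate-semilinear {G = G} (specAction on-F) (specAction on-Fˢʰ) (Spec₁ F→Fˢʰ)
            (Spec₁-semilinear on-F on-Fˢʰ F→Fˢʰ F→Fˢʰ-equivariant) σ A y ))
      -- The point is now the base change of `σ-𝒳 σ` followed by `i`; that `σ-𝒳 σ` extends `σ_X`
      -- moves the action across `i`.
      (proj₂ (isExtension σ) A _)

    reduce-equivariant : ∀ σ P →
      Setoid._≈_ 𝒳ₖ⟨k̄F⟩ (reduce ⟨$⟩ (move-𝒳 σ ⟨$⟩ P)) (move-𝒳ₖ σ ⟨$⟩ (reduce ⟨$⟩ P))
    reduce-equivariant σ (P , _) A y =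
      restrict-𝒳-equivariant on-k̄F OFˢʰ→k̄F OFˢʰ→k̄F-equivariant σ P A y ,
      conjugate-semilinear {G = G} (specAction on-kF) (specAction on-k̄F) (Spec₁ kF→k̄F)
        (Spec₁-semilinear on-kF on-k̄F kF→k̄F kF→k̄F-equivariant) σ A y

theorem3p1 :
  ∀ {ℓ g g′ : Level} (D : Setting ℓ) (G : Group g g′)
    (θ : GroupHomomorphism (Group.rawGroup G) (Group.rawGroup (GaloisActions.G_K D)))
    (X : Scheme ℓ) (X→F : functor X ⇒ Spec (Setting.F D))
    (ρ : SemilinearAction {G = G} (SpecActions.specAction D G θ (GaloisActions.on-F D)) X→F)
    (M : Model D X→F)
    (extend : SemilinearModel.ExtendsUniquely D G θ ρ M) →
  let open GaloisActions D using (on-OF)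
      open GaloisActions D using (on-kF)
      open SpecActions D G θ using (specAction)
      open Model M
      open SemilinearModel D G θ ρ M using (move-X)
      open SemilinearModel.Extended D G θ ρ M extend
      open Setoid using (_≈_)
  in
  -- (1)
  ( IsSemilinearAction {G = G} (specAction on-OF) 𝒳→OF σ-𝒳
  × IsSemilinearAction {G = G} (specAction on-kF) specialFibre→kF σ-𝒳ₖ
  × IsMonoidHomomorphism (Group.rawMonoid G) (EndSetoid 𝒳⟨OFˢʰ⟩) move-𝒳
  × IsMonoidHomomorphism (Group.rawMonoid G) (EndSetoid 𝒳ₖ⟨k̄F⟩) move-𝒳ₖ )
  ×
  -- (2)
  ( (∀ σ P → _≈_ X⟨Fˢʰ⟩ (toGeneric ⟨$⟩ (move-𝒳 σ ⟨$⟩ P)) (move-X σ ⟨$⟩ (toGeneric ⟨$⟩ P)))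
  × (∀ σ P → _≈_ 𝒳ₖ⟨k̄F⟩ (reduce ⟨$⟩ (move-𝒳 σ ⟨$⟩ P)) (move-𝒳ₖ σ ⟨$⟩ (reduce ⟨$⟩ P))) )
  ×
  -- (3): G acts on I by restriction of its action on 𝒳ₖ(k̄F), and for every
  -- P in I and every lift Q of P the point σ P is as described.
  ( (bijective : Bijective (_≈_ 𝒳⟨OFˢʰ⟩) (_≈_ X⟨Fˢʰ⟩) (toGeneric ⟨$⟩_)) →
    let toGeneric⁻¹ = λ R → proj₁ (proj₂ bijective R) in
    Σ[ a ∈ MonoidHomomorphism (Group.rawMonoid G) (EndSetoid I) ]
    let open MonoidHomomorphism a renaming (⟦_⟧ to move-I) in
    ( (∀ σ P → _≈_ 𝒳ₖ⟨k̄F⟩ (include ⟨$⟩ (move-I σ ⟨$⟩ P)) (move-𝒳ₖ σ ⟨$⟩ (include ⟨$⟩ P)))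
    × (∀ σ P Q → _≈_ 𝒳ₖ⟨k̄F⟩ (reduce ⟨$⟩ Q) (include ⟨$⟩ P) →
        _≈_ I (move-I σ ⟨$⟩ P) (reduceToI ⟨$⟩ toGeneric⁻¹ (move-X σ ⟨$⟩ (toGeneric ⟨$⟩ Q)))) ) )
theorem3p1 D G θ X X→F ρ M extend =
  (𝒳-action , 𝒳ₖ-action ,
    movePoint-action {G = G} (specAction on-OF) (specAction on-OFˢʰ) (Spec₁ OF→OFˢʰ) 𝒳→OF
      (Spec₁-semilinear on-OF on-OFˢʰ OF→OFˢʰ OF→OFˢʰ-equivariant) (proj₁ 𝒳-action) (proj₂ 𝒳-action) ,
    𝒳ₖ⟨k̄F⟩-action) ,
  (toGeneric-equivariant D G θ ρ M extend , reduce-equivariant D G θ ρ M extend) ,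
  λ (injective , surjective) →
    image-action {G = G} reduce {move-𝒳} {move-𝒳ₖ} 𝒳ₖ⟨k̄F⟩-action (reduce-equivariant D G θ ρ M extend) ,
    (λ σ P → Setoid.refl 𝒳ₖ⟨k̄F⟩ {move-𝒳ₖ σ ⟨$⟩ (include ⟨$⟩ P)}) ,
    λ σ P Q reduceQ≈P →
      let R  = move-X σ ⟨$⟩ (toGeneric ⟨$⟩ Q)
          σQ = move-𝒳 σ ⟨$⟩ Q
          Q′ = proj₁ (surjective R)
          σQ≈Q′ : Setoid._≈_ 𝒳⟨OFˢʰ⟩ σQ Q′
          -- Both `σQ` and `Q′` have generic point `R`: the first by equivariance, the second by the
          -- choice of preimage.
          σQ≈Q′ = injective {σQ} {Q′} (Setoid.trans X⟨Fˢʰ⟩ {toGeneric ⟨$⟩ σQ} {R} {toGeneric ⟨$⟩ Q′}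
            (toGeneric-equivariant D G θ ρ M extend σ Q)
            -- Surjectivity gives the image of every point equal to the chosen preimage; here it is
            -- used at that preimage itself.
            (Setoid.sym X⟨Fˢʰ⟩ {toGeneric ⟨$⟩ Q′} {R} (proj₂ (surjective R) {Q′} (Setoid.refl 𝒳⟨OFˢʰ⟩ {Q′}))))
          open SetoidReasoning 𝒳ₖ⟨k̄F⟩
      -- Equality in `I` is equality of the underlying points of `𝒳ₖ⟨k̄F⟩`, so the chain runs there,
      -- with `P` replaced first by the reduction of its lift `Q`.
      in begin
        move-𝒳ₖ σ ⟨$⟩ proj₁ P          ≈⟨ Func.cong (move-𝒳ₖ σ) {reduce ⟨$⟩ Q} {proj₁ P} reduceQ≈P ⟨
        move-𝒳ₖ σ ⟨$⟩ (reduce ⟨$⟩ Q)   ≈⟨ reduce-equivariant D G θ ρ M extend σ Q ⟨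
        reduce ⟨$⟩ σQ                  ≈⟨ Func.cong reduce {σQ} {Q′} σQ≈Q′ ⟩
        reduce ⟨$⟩ Q′                  ∎
  where
  open Setting D
  open GaloisActions D
  open SpecActions D G θ
  open Model M
  open SemilinearModel D G θ ρ M
  open Extended extend

  𝒳-action : IsSemilinearAction {G = G} (specAction on-OF) 𝒳→OF σ-𝒳
  𝒳-action = σ-𝒳-action D G θ ρ M extend , σ-𝒳-semilinear D G θ ρ M extend

  𝒳ₖ-action : IsSemilinearAction {G = G} (specAction on-kF) specialFibre→kF σ-𝒳ₖ
  𝒳ₖ-action = baseChange-action {G = G} (specAction on-OF) (specAction on-kF) {s = Spec₁ OF→kF} {x = 𝒳→OF}
    (Spec₁-semilinear on-OF on-kF OF→kF OF→kF-equivariant) (proj₁ 𝒳-action) (proj₂ 𝒳-action)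

  𝒳ₖ⟨k̄F⟩-action : IsMonoidHomomorphism (Group.rawMonoid G) (EndSetoid 𝒳ₖ⟨k̄F⟩) move-𝒳ₖ
  𝒳ₖ⟨k̄F⟩-action = movePoint-action {G = G} (specAction on-kF) (specAction on-k̄F) (Spec₁ kF→k̄F) specialFibre→kF
    (Spec₁-semilinear on-kF on-k̄F kF→k̄F kF→k̄F-equivariant) (proj₁ 𝒳ₖ-action) (proj₂ 𝒳ₖ-action)
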